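{- For all nonnegative integers $n$ and $m$, $$\det\left(\binom{i+j+m}{i-j+m}\right)_{i,j=0}^{n-1}=\prod_{j=1}^{n-1}\frac{j!}{(2j)!}\prod_{j=1}^{n-1}\frac{(2m+2j)!}{(2m+j)!}=\det\left(C_{n+i+j}\right)_{i,j=0}^{m-1},$$ where $C_\ell=\frac{1}{\ell+1}\binom{2\ell}{\ell}$ are the Catalan numbers.
   Context: Binomial coefficients $\binom{a}{b}$ with $a\ge0$ vanish if $b<0$ or $b>a$. Empty products and determinants of $0\times0$ matrices equal $1$. -}

module Defs where

open import Data.Nat as ℕ using (ℕ; zero; suc; _!)
open import Data.Nat.Properties using (_!≢0)
open import Data.Nat.Combinatorics using (_C_)
open import Data.Integer as ℤ using (ℤ; +_; -[1+_])
open import Data.Fin using (Fin; zero; suc; punchIn; toℕ)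
open import Data.Rational as ℚ using (ℚ; _+_; _*_; -_; _/_; 0ℚ; 1ℚ)

-- Binomial coefficient (a choose b) for a ∈ ℕ and b ∈ ℤ:
-- zero if b < 0 or b > a (stdlib's _C_ already returns 0 when b > a).
binom : ℕ → ℤ → ℕ
binom a (+ b)    = a C b
binom a -[1+ _ ] = 0

∑ : ∀ n → (Fin n → ℚ) → ℚ
∑ zero    f = 0ℚ
∑ (suc n) f = f zero + ∑ n (λ i → f (suc i))

sgn : ℕ → ℚ
sgn zero    = 1ℚ
sgn (suc k) = - sgn k

det : ∀ n → (Fin n → Fin n → ℚ) → ℚ
det zero    M = 1ℚ
det (suc n) M =
  ∑ (suc n) (λ i → sgn (toℕ i) * (M i zero * det n (λ r c → M (punchIn i r) (suc c))))

∏[1…_] : ℕ → (ℕ → ℚ) → ℚ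
∏[1… zero  ] f = 1ℚ
∏[1… suc k ] f = ∏[1… k ] f * f (suc k)

fact-ratio : ℕ → ℕ → ℚ
fact-ratio a b = (+ (a !)) / (b !)
  where instance _ = b !≢0

catalan : ℕ → ℚ
catalan ℓ = (+ ((2 ℕ.* ℓ) C ℓ)) / (suc ℓ)

ℕ→ℚ : ℕ → ℚ
ℕ→ℚ k = (+ k) / 1

{-# OPTIONS --safe #-}
-- Both determinants are evaluated by Gaussian elimination. Subtracting from each row a multiple of
-- the previous one so as to clear the first column leaves, after removing row and column factors,
-- a matrix of the same shape with a shifted parameter.
--   * Up to the factors 1/(2j)! the binomial matrix is the case s = 0 of the falling factorials
--     y^(2j+s) at y = i + j + m + s; elimination raises s by one.
--   * The Catalan matrix is the case t = 1 of (2l)! / (l! (l+t)!) at l = n + i + j; elimination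
--     raises both t and n by one.
-- So the pivots satisfy a first order recursion, solved by a quotient of factorials. The pivots of
-- the first determinant are, up to the factors 1/(2j)!, the terms of the product formula; those of
-- the second are the quotients of its values at m + 1 and m.
module Submission where

open import Defs
open import Data.Nat as ℕ using (ℕ; zero; suc; _+_; _*_; _∸_; _!)
import Data.Nat.Properties as ℕ
open import Data.Nat.Combinatorics using (_C_; nCk≡n!/k![n-k]!; nCk≡nC[n∸k]; k>n⇒nCk≡0; k![n∸k]!∣n!)
open import Data.Nat.Combinatorics.Base using (_P′_)
open import Data.Nat.Combinatorics.Specification using (nP′k≡n[n∸1P′k∸1]; k!∣nP′k; nC′k≡n!/k![n-k]!)
open import Data.Nat.DivMod using (m/n*n≡m)
import Data.Nat.Solver as ℕ-Solver
open import Data.Integer as ℤ using (+_)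
import Data.Integer.Properties as ℤ
open import Data.Fin using (Fin; zero; suc; toℕ; fromℕ<; inject₁; punchIn; punchOut; _≟_)
open import Data.Fin.Properties
  using (toℕ-inject₁; toℕ-injective; toℕ<n; toℕ-fromℕ<; suc-injective;
         punchInᵢ≢i; punchIn-punchOut; punchIn-injective)
open import Data.Product using (_×_; _,_; ∃-syntax)
open import Data.Vec.Functional using (updateAt)
open import Data.Vec.Functional.Properties using (updateAt-updates; updateAt-minimal)
open import Data.Rational as ℚ using (ℚ; 0ℚ; 1ℚ; fromℚᵘ)
import Data.Rational.Properties as ℚ
open import Data.Rational.Solver using (module +-*-Solver)
open import Data.Rational.Unnormalised as ℚᵘ using (mkℚᵘ; *≡*)
import Data.Rational.Unnormalised.Properties as ℚᵘ
open import Function using (_∘_; const)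
open import Relation.Nullary using (yes; no; contradiction)
open import Relation.Binary.PropositionalEquality

open ≡-Reasoning
open +-*-Solver
open ℕ-Solver.+-*-Solver using ()
  renaming (solve to ℕ-solve; _:+_ to _⊞_; _:*_ to _⊠_; _:=_ to _⊜_; con to lit)

-- Determinants

Matrix : ℕ → Set
Matrix n = Fin n → Fin n → ℚ

minor : ∀ {n} → Fin (suc n) → Matrix (suc n) → Matrix n
minor i M r c = M (punchIn i r) (suc c)

laplace : ∀ {n} → Matrix (suc n) → Fin (suc n) → ℚ
laplace {n} M i = sgn (toℕ i) ℚ.* (M i zero ℚ.* det n (minor i M))

-- Finite sums

∑-cong : ∀ n {f g : Fin n → ℚ} → (∀ i → f i ≡ g i) → ∑ n f ≡ ∑ n g
∑-cong zero    f≡g = refl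
∑-cong (suc n) f≡g = cong₂ ℚ._+_ (f≡g zero) (∑-cong n (f≡g ∘ suc))

∑-zero : ∀ n {f : Fin n → ℚ} → (∀ i → f i ≡ 0ℚ) → ∑ n f ≡ 0ℚ
∑-zero zero    f≡0 = refl
∑-zero (suc n) f≡0 = trans (cong₂ ℚ._+_ (f≡0 zero) (∑-zero n (f≡0 ∘ suc))) (ℚ.+-identityˡ 0ℚ)

∑-linear : ∀ n b (f g : Fin n → ℚ) →
  ∑ n (λ i → b ℚ.* f i ℚ.+ g i) ≡ b ℚ.* ∑ n f ℚ.+ ∑ n g
∑-linear zero b f g = solve 1 (λ b → con 0ℚ := b :* con 0ℚ :+ con 0ℚ) refl b
∑-linear (suc n) b f g = begin
  b ℚ.* f zero ℚ.+ g zero ℚ.+ ∑ n (λ i → b ℚ.* f (suc i) ℚ.+ g (suc i))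
    ≡⟨ cong (b ℚ.* f zero ℚ.+ g zero ℚ.+_) (∑-linear n b (f ∘ suc) (g ∘ suc)) ⟩
  b ℚ.* f zero ℚ.+ g zero ℚ.+ (b ℚ.* ∑ n (f ∘ suc) ℚ.+ ∑ n (g ∘ suc))
    ≡⟨ solve 5 (λ b x y s t → b :* x :+ y :+ (b :* s :+ t) := b :* (x :+ s) :+ (y :+ t))
         refl b (f zero) (g zero) (∑ n (f ∘ suc)) (∑ n (g ∘ suc)) ⟩
  b ℚ.* ∑ (suc n) f ℚ.+ ∑ (suc n) g ∎

*-distribˡ-∑ : ∀ n b (f : Fin n → ℚ) → ∑ n (λ i → b ℚ.* f i) ≡ b ℚ.* ∑ n f
*-distribˡ-∑ zero    b f = sym (ℚ.*-zeroʳ b)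
*-distribˡ-∑ (suc n) b f =
  trans (cong (b ℚ.* f zero ℚ.+_) (*-distribˡ-∑ n b (f ∘ suc))) (sym (ℚ.*-distribˡ-+ b _ _))

-- The shape of the Laplace expansion when two adjacent rows are equal: their two terms cancel and
-- all others vanish.
∑-cancel : ∀ {n} (k : Fin n) (f : Fin (suc n) → ℚ) → f (inject₁ k) ℚ.+ f (suc k) ≡ 0ℚ →
  (∀ i → i ≢ inject₁ k → i ≢ suc k → f i ≡ 0ℚ) → ∑ (suc n) f ≡ 0ℚ
∑-cancel {suc n} zero f cancel others = begin
  f zero ℚ.+ (f (suc zero) ℚ.+ ∑ n (λ i → f (suc (suc i))))
    ≡⟨ ℚ.+-assoc (f zero) _ _ ⟨
  f zero ℚ.+ f (suc zero) ℚ.+ ∑ n (λ i → f (suc (suc i)))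
    ≡⟨ cong₂ ℚ._+_ cancel (∑-zero n (λ i → others (suc (suc i)) (λ ()) (λ ()))) ⟩
  0ℚ ℚ.+ 0ℚ
    ≡⟨ ℚ.+-identityˡ 0ℚ ⟩
  0ℚ ∎
∑-cancel {suc n} (suc k) f cancel others = begin
  f zero ℚ.+ ∑ (suc n) (f ∘ suc)
    ≡⟨ cong₂ ℚ._+_ (others zero (λ ()) (λ ()))
         (∑-cancel k (f ∘ suc) cancel
            (λ i i≢ i≢′ → others (suc i) (i≢ ∘ suc-injective) (i≢′ ∘ suc-injective))) ⟩
  0ℚ ℚ.+ 0ℚ
    ≡⟨ ℚ.+-identityˡ 0ℚ ⟩
  0ℚ ∎

-- Linearity in a row and equal adjacent rows

det-cong : ∀ n {A B : Matrix n} → (∀ i j → A i j ≡ B i j) → det n A ≡ det n B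
det-cong zero    A≡B = refl
det-cong (suc n) A≡B = ∑-cong (suc n) λ i →
  cong (sgn (toℕ i) ℚ.*_)
    (cong₂ ℚ._*_ (A≡B i zero) (det-cong n (λ r c → A≡B (punchIn i r) (suc c))))

-- Induction along the Laplace expansion. The term of row `k` is linear through its entry, since its
-- minor omits that row; every other term is linear through its minor, where row `k` sits at
-- position `punchOut i≢k`.
det-row-linear : ∀ {n} (k : Fin n) b {A B A′ : Matrix n} →
  (∀ j → A′ k j ≡ b ℚ.* B k j ℚ.+ A k j) →
  (∀ i j → i ≢ k → A′ i j ≡ A i j) → (∀ i j → i ≢ k → A′ i j ≡ B i j) →
  det n A′ ≡ b ℚ.* det n B ℚ.+ det n A
det-row-linear {suc n} k b {A} {B} {A′} A′k A′≡A A′≡B = begin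
  det (suc n) A′
    ≡⟨ ∑-cong (suc n) term ⟩
  ∑ (suc n) (λ i → b ℚ.* laplace B i ℚ.+ laplace A i)
    ≡⟨ ∑-linear (suc n) b (laplace B) (laplace A) ⟩
  b ℚ.* det (suc n) B ℚ.+ det (suc n) A ∎
  where
  term : ∀ i → laplace A′ i ≡ b ℚ.* laplace B i ℚ.+ laplace A i
  term i with i ≟ k
  ... | yes refl = begin
    s ℚ.* (A′ i zero ℚ.* det n (minor i A′))
      ≡⟨ cong (λ x → s ℚ.* (x ℚ.* det n (minor i A′))) (A′k zero) ⟩
    s ℚ.* ((b ℚ.* B i zero ℚ.+ A i zero) ℚ.* det n (minor i A′))
      ≡⟨ solve 5 (λ s b x y d → s :* ((b :* x :+ y) :* d) := b :* (s :* (x :* d)) :+ s :* (y :* d))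
           refl s b (B i zero) (A i zero) (det n (minor i A′)) ⟩
    b ℚ.* (s ℚ.* (B i zero ℚ.* det n (minor i A′))) ℚ.+ s ℚ.* (A i zero ℚ.* det n (minor i A′))
      ≡⟨ cong₂ (λ x y → b ℚ.* (s ℚ.* (B i zero ℚ.* x)) ℚ.+ s ℚ.* (A i zero ℚ.* y))
           (det-cong n (λ r c → A′≡B _ _ (punchInᵢ≢i i r)))
           (det-cong n (λ r c → A′≡A _ _ (punchInᵢ≢i i r))) ⟩
    b ℚ.* (s ℚ.* (B i zero ℚ.* det n (minor i B))) ℚ.+ s ℚ.* (A i zero ℚ.* det n (minor i A)) ∎
    where s = sgn (toℕ i)
  ... | no i≢k = begin
    s ℚ.* (A′ i zero ℚ.* det n (minor i A′))
      ≡⟨ cong (λ x → s ℚ.* (A′ i zero ℚ.* x)) (det-row-linear (punchOut i≢k) b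
           (λ j → subst (λ r → A′ r (suc j) ≡ b ℚ.* B r (suc j) ℚ.+ A r (suc j)) (sym at-k) (A′k (suc j)))
           (λ r c r≢ → A′≡A _ _ (off-k r r≢)) (λ r c r≢ → A′≡B _ _ (off-k r r≢))) ⟩
    s ℚ.* (A′ i zero ℚ.* (b ℚ.* det n (minor i B) ℚ.+ det n (minor i A)))
      ≡⟨ solve 5 (λ s b x d e → s :* (x :* (b :* d :+ e)) := b :* (s :* (x :* d)) :+ s :* (x :* e))
           refl s b (A′ i zero) (det n (minor i B)) (det n (minor i A)) ⟩
    b ℚ.* (s ℚ.* (A′ i zero ℚ.* det n (minor i B))) ℚ.+ s ℚ.* (A′ i zero ℚ.* det n (minor i A))
      ≡⟨ cong₂ (λ x y → b ℚ.* (s ℚ.* (x ℚ.* det n (minor i B))) ℚ.+ s ℚ.* (y ℚ.* det n (minor i A)))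
           (A′≡B i zero i≢k) (A′≡A i zero i≢k) ⟩
    b ℚ.* (s ℚ.* (B i zero ℚ.* det n (minor i B))) ℚ.+ s ℚ.* (A i zero ℚ.* det n (minor i A)) ∎
    where
    s = sgn (toℕ i)
    at-k : punchIn i (punchOut i≢k) ≡ k
    at-k = punchIn-punchOut i≢k
    off-k : ∀ r → r ≢ punchOut i≢k → punchIn i r ≢ k
    off-k r r≢ eq = r≢ (punchIn-injective i _ _ (trans eq (sym at-k)))

-- Feeds the induction in `det-adjacent-rows`: the two equal rows are still adjacent in any minor
-- that keeps both.
punchIn-adjacent : ∀ {n} (i : Fin (suc (suc n))) (k : Fin (suc n)) → i ≢ inject₁ k → i ≢ suc k →
  ∃[ l ] (punchIn i (inject₁ {n} l) ≡ inject₁ k × punchIn i (suc l) ≡ suc k)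
punchIn-adjacent zero          zero    i≢ _  = contradiction refl i≢
punchIn-adjacent zero          (suc k) _  _  = k , refl , refl
punchIn-adjacent (suc zero)    zero    _  i≢ = contradiction refl i≢
punchIn-adjacent {suc n} (suc (suc i)) zero _ _ = zero , refl , refl
punchIn-adjacent {suc n} (suc i) (suc k) i≢ i≢′
  with l , p , q ← punchIn-adjacent i k (i≢ ∘ cong suc) (i≢′ ∘ cong suc) =
  suc l , cong suc p , cong suc q

-- Makes the minors at the two equal rows coincide: whichever of them is deleted, the same rows
-- remain.
delete-adjacent : ∀ {a} {A : Set a} {n} (k : Fin n) (f : Fin (suc n) → A) → f (inject₁ k) ≡ f (suc k) →
  ∀ r → f (punchIn (inject₁ k) r) ≡ f (punchIn (suc k) r)
delete-adjacent zero    f eq zero    = sym eq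
delete-adjacent zero    f eq (suc r) = refl
delete-adjacent (suc k) f eq zero    = refl
delete-adjacent (suc k) f eq (suc r) = delete-adjacent k (f ∘ suc) eq r

sgn-inject₁ : ∀ {n} (k : Fin n) → sgn (toℕ (inject₁ k)) ≡ sgn (toℕ k)
sgn-inject₁ zero    = refl
sgn-inject₁ (suc k) = cong ℚ.-_ (sgn-inject₁ k)

-- The two equal rows have equal minors and opposite signs, so their terms cancel; every other minor
-- contains both rows side by side and vanishes by induction.
det-adjacent-rows : ∀ {n} (k : Fin n) (M : Matrix (suc n)) →
  (∀ j → M (inject₁ k) j ≡ M (suc k) j) → det (suc n) M ≡ 0ℚ
det-adjacent-rows {suc n} k M eq = ∑-cancel k (laplace M) cancel others
  where
  cancel : laplace M (inject₁ k) ℚ.+ laplace M (suc k) ≡ 0ℚ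
  cancel = begin
    laplace M (inject₁ k) ℚ.+ laplace M (suc k)
      ≡⟨ cong (ℚ._+ laplace M (suc k)) (cong₂ ℚ._*_ (sgn-inject₁ k) (cong₂ ℚ._*_ (eq zero)
           (det-cong (suc n) (λ r c → delete-adjacent k (λ i → M i (suc c)) (eq (suc c)) r)))) ⟩
    sgn (toℕ k) ℚ.* (M (suc k) zero ℚ.* det (suc n) (minor (suc k) M)) ℚ.+ laplace M (suc k)
      ≡⟨ solve 3 (λ s x d → s :* (x :* d) :+ (:- s) :* (x :* d) := con 0ℚ)
           refl (sgn (toℕ k)) (M (suc k) zero) (det (suc n) (minor (suc k) M)) ⟩
    0ℚ ∎
  others : ∀ i → i ≢ inject₁ k → i ≢ suc k → laplace M i ≡ 0ℚ
  others i i≢ i≢′ with l , p , q ← punchIn-adjacent i k i≢ i≢′ = begin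
    laplace M i
      ≡⟨ cong (λ x → sgn (toℕ i) ℚ.* (M i zero ℚ.* x)) (det-adjacent-rows l (minor i M)
           (λ j → trans (cong (λ r → M r (suc j)) p)
                   (trans (eq (suc j)) (cong (λ r → M r (suc j)) (sym q))))) ⟩
    sgn (toℕ i) ℚ.* (M i zero ℚ.* 0ℚ)
      ≡⟨ solve 2 (λ s x → s :* (x :* con 0ℚ) := con 0ℚ) refl (sgn (toℕ i)) (M i zero) ⟩
    0ℚ ∎

-- By linearity in row `suc k`, the determinant changes by `b` times that of a matrix `B` in which
-- row `inject₁ k` occurs twice in succession.
det-add-row : ∀ {n} (k : Fin n) b {A A′ : Matrix (suc n)} →
  (∀ j → A′ (suc k) j ≡ b ℚ.* A (inject₁ k) j ℚ.+ A (suc k) j) →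
  (∀ i j → i ≢ suc k → A′ i j ≡ A i j) → det (suc n) A′ ≡ det (suc n) A
det-add-row {n} k b {A} {A′} A′k A′≡A = begin
  det (suc n) A′
    ≡⟨ det-row-linear (suc k) b
         (λ j → trans (A′k j) (cong (λ x → b ℚ.* x ℚ.+ A (suc k) j) (sym (B-at j))))
         A′≡A (λ i j i≢ → trans (A′≡A i j i≢) (sym (B-off i j i≢))) ⟩
  b ℚ.* det (suc n) B ℚ.+ det (suc n) A
    ≡⟨ cong (λ x → b ℚ.* x ℚ.+ det (suc n) A) (det-adjacent-rows k B
         (λ j → trans (B-off (inject₁ k) j inject₁≢suc) (sym (B-at j)))) ⟩
  b ℚ.* 0ℚ ℚ.+ det (suc n) A
    ≡⟨ solve 2 (λ b d → b :* con 0ℚ :+ d := d) refl b (det (suc n) A) ⟩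
  det (suc n) A ∎
  where
  B : Matrix (suc n)
  B = updateAt A (suc k) (const (A (inject₁ k)))
  B-at : ∀ j → B (suc k) j ≡ A (inject₁ k) j
  B-at j = cong (λ row → row j) (updateAt-updates (suc k) A)
  B-off : ∀ i j → i ≢ suc k → B i j ≡ A i j
  B-off i j i≢ = cong (λ row → row j) (updateAt-minimal i (suc k) A i≢)
  inject₁≢suc : inject₁ k ≢ suc k
  inject₁≢suc eq = ℕ.1+n≢n (sym (trans (sym (toℕ-inject₁ k)) (cong toℕ eq)))

-- Clearing the first column

splice : ∀ {a} {X : Set a} {n} → ℕ → (A B : Fin n → X) → Fin n → X
splice k A B i with toℕ i ℕ.<? k
... | yes _ = A i
... | no  _ = B i

splice-< : ∀ {a} {X : Set a} {n k} (A B : Fin n → X) {i} → toℕ i ℕ.< k → splice k A B i ≡ A i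
splice-< {k = k} A B {i} i<k with toℕ i ℕ.<? k
... | yes _  = refl
... | no i≮k = contradiction i<k i≮k

splice-≥ : ∀ {a} {X : Set a} {n k} (A B : Fin n → X) {i} → k ℕ.≤ toℕ i → splice k A B i ≡ B i
splice-≥ {k = k} A B {i} k≤i with toℕ i ℕ.<? k
... | yes i<k = contradiction i<k (ℕ.≤⇒≯ k≤i)
... | no  _   = refl

-- The hybrids `splice k A B`, with the first `k` rows from `A`, interpolate between `B` and `A`.
-- Consecutive ones differ in a single row, by a multiple of the row above it.
det-clear-rows : ∀ {n} {A B : Matrix (suc n)} (b : Fin n → ℚ) → (∀ j → A zero j ≡ B zero j) →
  (∀ i j → A (suc i) j ≡ b i ℚ.* A (inject₁ i) j ℚ.+ B (suc i) j) → det (suc n) A ≡ det (suc n) B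
det-clear-rows {n} {A} {B} b A₀ Aₛ = begin
  det (suc n) A
    ≡⟨ det-cong (suc n) (λ i j → cong (λ row → row j) (sym (splice-< A B (toℕ<n i)))) ⟩
  det (suc n) (splice (suc n) A B)
    ≡⟨ descend n ℕ.≤-refl ⟩
  det (suc n) (splice 1 A B)
    ≡⟨ det-cong (suc n) first ⟩
  det (suc n) B ∎
  where
  first : ∀ i j → splice 1 A B i j ≡ B i j
  first zero    j = A₀ j
  first (suc i) j = refl

  step : (k : Fin n) →
    det (suc n) (splice (suc (suc (toℕ k))) A B) ≡ det (suc n) (splice (suc (toℕ k)) A B)
  step k = det-add-row k (b k) at-k off-k
    where
    at-k : ∀ j → splice (suc (suc (toℕ k))) A B (suc k) j
      ≡ b k ℚ.* splice (suc (toℕ k)) A B (inject₁ k) j ℚ.+ splice (suc (toℕ k)) A B (suc k) j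
    at-k j = begin
      splice (suc (suc (toℕ k))) A B (suc k) j
        ≡⟨ cong (λ row → row j) (splice-< A B ℕ.≤-refl) ⟩
      A (suc k) j
        ≡⟨ Aₛ k j ⟩
      b k ℚ.* A (inject₁ k) j ℚ.+ B (suc k) j
        ≡⟨ cong₂ (λ r s → b k ℚ.* r j ℚ.+ s j)
             (sym (splice-< A B {inject₁ k} (ℕ.≤-reflexive (cong suc (toℕ-inject₁ k)))))
             (sym (splice-≥ A B {suc k} ℕ.≤-refl)) ⟩
      b k ℚ.* splice (suc (toℕ k)) A B (inject₁ k) j ℚ.+ splice (suc (toℕ k)) A B (suc k) j ∎
    off-k : ∀ i j → i ≢ suc k → splice (suc (suc (toℕ k))) A B i j ≡ splice (suc (toℕ k)) A B i j
    -- Rows up to `k` come from `A` in both hybrids, rows beyond `suc k` from `B`.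
    off-k i j i≢ with toℕ i ℕ.≤? toℕ k
    ... | yes i≤k = cong (λ row → row j)
      (trans (splice-< A B (ℕ.m≤n⇒m≤1+n (ℕ.s≤s i≤k))) (sym (splice-< A B (ℕ.s≤s i≤k))))
    ... | no  i≰k = cong (λ row → row j)
      (trans (splice-≥ A B 1+k<i) (sym (splice-≥ A B (ℕ.<⇒≤ 1+k<i))))
      where
      1+k<i : suc (toℕ k) ℕ.< toℕ i
      1+k<i = ℕ.≤∧≢⇒< (ℕ.≰⇒> i≰k) (λ eq → i≢ (toℕ-injective (sym eq)))

  -- Bottom up, so that the row above the one being cleared is still a row of A.
  descend : ∀ k → k ℕ.≤ n → det (suc n) (splice (suc k) A B) ≡ det (suc n) (splice 1 A B)
  descend zero    _   = refl
  descend (suc k) k<n = trans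
    (subst (λ l → det (suc n) (splice (suc (suc l)) A B) ≡ det (suc n) (splice (suc l) A B))
      (toℕ-fromℕ< k<n) (step (fromℕ< k<n)))
    (descend k (ℕ.<⇒≤ k<n))

det-first-column : ∀ {n} (M : Matrix (suc n)) → (∀ i → M (suc i) zero ≡ 0ℚ) →
  det (suc n) M ≡ M zero zero ℚ.* det n (λ i j → M (suc i) (suc j))
det-first-column {n} M M₀ = begin
  laplace M zero ℚ.+ ∑ n (λ i → laplace M (suc i))
    ≡⟨ cong (laplace M zero ℚ.+_) (∑-zero n vanish) ⟩
  laplace M zero ℚ.+ 0ℚ
    ≡⟨ solve 2 (λ x d → con 1ℚ :* (x :* d) :+ con 0ℚ := x :* d) refl
         (M zero zero) (det n (minor zero M)) ⟩
  M zero zero ℚ.* det n (minor zero M) ∎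
  where
  vanish : ∀ i → laplace M (suc i) ≡ 0ℚ
  vanish i = trans
    (cong (λ x → sgn (toℕ (suc i)) ℚ.* (x ℚ.* det n (minor (suc i) M))) (M₀ i))
    (solve 2 (λ s d → s :* (con 0ℚ :* d) := con 0ℚ) refl (sgn (toℕ (suc i))) (det n (minor (suc i) M)))

-- Finite products; scaling of rows and columns

∏ : ∀ n → (Fin n → ℚ) → ℚ
∏ zero    f = 1ℚ
∏ (suc n) f = f zero ℚ.* ∏ n (λ i → f (suc i))

∏-cong : ∀ n {f g : Fin n → ℚ} → (∀ i → f i ≡ g i) → ∏ n f ≡ ∏ n g
∏-cong zero    f≡g = refl
∏-cong (suc n) f≡g = cong₂ ℚ._*_ (f≡g zero) (∏-cong n (f≡g ∘ suc))

∏-distrib-* : ∀ n (f g : Fin n → ℚ) → ∏ n (λ i → f i ℚ.* g i) ≡ ∏ n f ℚ.* ∏ n g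
∏-distrib-* zero    f g = sym (ℚ.*-identityˡ 1ℚ)
∏-distrib-* (suc n) f g = begin
  f zero ℚ.* g zero ℚ.* ∏ n (λ i → f (suc i) ℚ.* g (suc i))
    ≡⟨ cong (f zero ℚ.* g zero ℚ.*_) (∏-distrib-* n (f ∘ suc) (g ∘ suc)) ⟩
  f zero ℚ.* g zero ℚ.* (∏ n (f ∘ suc) ℚ.* ∏ n (g ∘ suc))
    ≡⟨ solve 4 (λ x y p q → x :* y :* (p :* q) := x :* p :* (y :* q)) refl
         (f zero) (g zero) (∏ n (f ∘ suc)) (∏ n (g ∘ suc)) ⟩
  ∏ (suc n) f ℚ.* ∏ (suc n) g ∎

-- The minor at `i` carries all row factors but the `i`-th, which the entry in front of it supplies
-- in `det-scale`.
∏-punchIn : ∀ {n} (i : Fin (suc n)) (f : Fin (suc n) → ℚ) →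
  ∏ (suc n) f ≡ f i ℚ.* ∏ n (λ r → f (punchIn i r))
∏-punchIn zero f = refl
∏-punchIn {suc n} (suc i) f = begin
  f zero ℚ.* ∏ (suc n) (f ∘ suc)
    ≡⟨ cong (f zero ℚ.*_) (∏-punchIn i (f ∘ suc)) ⟩
  f zero ℚ.* (f (suc i) ℚ.* ∏ n (λ r → f (suc (punchIn i r))))
    ≡⟨ solve 3 (λ x y p → x :* (y :* p) := y :* (x :* p)) refl
         (f zero) (f (suc i)) (∏ n (λ r → f (suc (punchIn i r)))) ⟩
  f (suc i) ℚ.* (f zero ℚ.* ∏ n (λ r → f (suc (punchIn i r)))) ∎

det-scale : ∀ n (r γ : Fin n → ℚ) (M : Matrix n) →
  det n (λ i j → r i ℚ.* γ j ℚ.* M i j) ≡ ∏ n r ℚ.* ∏ n γ ℚ.* det n M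
det-scale zero    r γ M = solve 0 (con 1ℚ := con 1ℚ :* con 1ℚ :* con 1ℚ) refl
det-scale (suc n) r γ M =
  trans (∑-cong (suc n) term) (*-distribˡ-∑ (suc n) (∏ (suc n) r ℚ.* ∏ (suc n) γ) (laplace M))
  where
  term : ∀ i → laplace (λ i j → r i ℚ.* γ j ℚ.* M i j) i ≡ ∏ (suc n) r ℚ.* ∏ (suc n) γ ℚ.* laplace M i
  term i = begin
    s ℚ.* (r i ℚ.* γ zero ℚ.* M i zero ℚ.* det n (minor i (λ i j → r i ℚ.* γ j ℚ.* M i j)))
      ≡⟨ cong (λ x → s ℚ.* (r i ℚ.* γ zero ℚ.* M i zero ℚ.* x))
           (det-scale n (λ k → r (punchIn i k)) (γ ∘ suc) (minor i M)) ⟩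
    s ℚ.* (r i ℚ.* γ zero ℚ.* M i zero ℚ.* (R ℚ.* ∏ n (γ ∘ suc) ℚ.* det n (minor i M)))
      ≡⟨ solve 7 (λ s r g x R G d →
           s :* (r :* g :* x :* (R :* G :* d)) := r :* R :* (g :* G) :* (s :* (x :* d)))
           refl s (r i) (γ zero) (M i zero) R (∏ n (γ ∘ suc)) (det n (minor i M)) ⟩
    r i ℚ.* R ℚ.* ∏ (suc n) γ ℚ.* laplace M i
      ≡⟨ cong (λ x → x ℚ.* ∏ (suc n) γ ℚ.* laplace M i) (sym (∏-punchIn i r)) ⟩
    ∏ (suc n) r ℚ.* ∏ (suc n) γ ℚ.* laplace M i ∎
    where
    s = sgn (toℕ i)
    R = ∏ n (λ k → r (punchIn i k))

-- Casts from ℕ to ℚ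

fromℚᵘ-homo-+ : ∀ p q → fromℚᵘ (p ℚᵘ.+ q) ≡ fromℚᵘ p ℚ.+ fromℚᵘ q
fromℚᵘ-homo-+ p q = ℚ.toℚᵘ-injective (ℚᵘ.≃-trans (ℚ.toℚᵘ-fromℚᵘ (p ℚᵘ.+ q))
  (ℚᵘ.≃-sym (ℚᵘ.≃-trans (ℚ.toℚᵘ-homo-+ (fromℚᵘ p) (fromℚᵘ q))
    (ℚᵘ.+-cong (ℚ.toℚᵘ-fromℚᵘ p) (ℚ.toℚᵘ-fromℚᵘ q)))))

fromℚᵘ-homo-* : ∀ p q → fromℚᵘ (p ℚᵘ.* q) ≡ fromℚᵘ p ℚ.* fromℚᵘ q
fromℚᵘ-homo-* p q = ℚ.toℚᵘ-injective (ℚᵘ.≃-trans (ℚ.toℚᵘ-fromℚᵘ (p ℚᵘ.* q))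
  (ℚᵘ.≃-sym (ℚᵘ.≃-trans (ℚ.toℚᵘ-homo-* (fromℚᵘ p) (fromℚᵘ q))
    (ℚᵘ.*-cong (ℚ.toℚᵘ-fromℚᵘ p) (ℚ.toℚᵘ-fromℚᵘ q)))))

ℕ→ℚ-homo-+ : ∀ a b → ℕ→ℚ (a + b) ≡ ℕ→ℚ a ℚ.+ ℕ→ℚ b
ℕ→ℚ-homo-+ a b = trans
  -- The unnormalised sum of `a / 1` and `b / 1` has numerator `a * 1 + b * 1`.
  (cong (λ z → z ℚ./ 1) (cong₂ ℤ._+_ (sym (ℤ.*-identityʳ (+ a))) (sym (ℤ.*-identityʳ (+ b)))))
  (fromℚᵘ-homo-+ (mkℚᵘ (+ a) 0) (mkℚᵘ (+ b) 0))

ℕ→ℚ-homo-* : ∀ a b → ℕ→ℚ (a * b) ≡ ℕ→ℚ a ℚ.* ℕ→ℚ b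
ℕ→ℚ-homo-* a b = trans (cong (λ z → z ℚ./ 1) (ℤ.pos-* a b))
  (fromℚᵘ-homo-* (mkℚᵘ (+ a) 0) (mkℚᵘ (+ b) 0))

/-*-cancel : ∀ a d .{{_ : ℕ.NonZero d}} → (+ a) ℚ./ d ℚ.* ℕ→ℚ d ≡ ℕ→ℚ a
/-*-cancel a (suc d) = trans (sym (fromℚᵘ-homo-* (mkℚᵘ (+ a) d) (mkℚᵘ (+ suc d) 0)))
  (ℚ.fromℚᵘ-cong {mkℚᵘ (+ a) d ℚᵘ.* mkℚᵘ (+ suc d) 0} {mkℚᵘ (+ a) 0} (*≡* (begin
    + a ℤ.* + suc d ℤ.* + 1
      ≡⟨ ℤ.*-identityʳ (+ a ℤ.* + suc d) ⟩
    + a ℤ.* + suc d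
      ≡⟨ cong (λ k → + a ℤ.* + k) (sym (ℕ.*-identityʳ (suc d))) ⟩
    + a ℤ.* + (suc d * 1) ∎)))

ℕ→ℚ-*-cancelˡ : ∀ d .{{_ : ℕ.NonZero d}} {x y} → ℕ→ℚ d ℚ.* x ≡ ℕ→ℚ d ℚ.* y → x ≡ y
ℕ→ℚ-*-cancelˡ d {x} {y} eq = trans (sym (undo x)) (trans (cong ((+ 1) ℚ./ d ℚ.*_) eq) (undo y))
  where
  undo : ∀ z → (+ 1) ℚ./ d ℚ.* (ℕ→ℚ d ℚ.* z) ≡ z
  undo z = trans (sym (ℚ.*-assoc ((+ 1) ℚ./ d) (ℕ→ℚ d) z))
    (trans (cong (ℚ._* z) (/-*-cancel 1 d)) (ℚ.*-identityˡ z))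

-- Elimination

-- M (suc s) is what is left of M s, up to row and column factors, once its first column has been
-- cleared; d s i is the i-th pivot of M s.
module Elimination
  (M : ℕ → ℕ → ℕ → ℚ) (α β ρ : ℕ → ℕ → ℕ) (γ : ℕ → ℕ) (d : ℕ → ℕ → ℚ)
  (M-first : ∀ s i → ℕ→ℚ (suc (α s i)) ℚ.* M s (suc i) 0 ≡ ℕ→ℚ (β s i) ℚ.* M s i 0)
  (M-rest : ∀ s i j → ℕ→ℚ (suc (α s i)) ℚ.* M s (suc i) (suc j)
    ≡ ℕ→ℚ (β s i) ℚ.* M s i (suc j) ℚ.+ ℕ→ℚ (ρ s i) ℚ.* ℕ→ℚ (γ j) ℚ.* M (suc s) i j)
  (d-first : ∀ s → d s 0 ≡ M s 0 0)
  (d-rest : ∀ s i → ℕ→ℚ (suc (α s i)) ℚ.* d s (suc i) ≡ ℕ→ℚ (ρ s i) ℚ.* ℕ→ℚ (γ i) ℚ.* d (suc s) i)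
  where

  -- Induction on `n`, for all `s` at once. Divided by `suc (α s i)`, the hypotheses `M-first` and
  -- `M-rest` say that subtracting a multiple of row `i` from row `i + 1` leaves 0 in the first
  -- column and, beyond it, `M (suc s)` scaled by the row factors `r` and the column factors `c`. By
  -- `d-rest` the pivots scale by the same factors.
  det-pivots : ∀ n s → det n (λ i j → M s (toℕ i) (toℕ j)) ≡ ∏ n (λ i → d s (toℕ i))
  det-pivots zero    s = refl
  det-pivots (suc n) s = begin
    det (suc n) A
      ≡⟨ det-clear-rows {A = A} {B} (λ i → v i ℚ.* ℕ→ℚ (β s (toℕ i))) A₀ Aₛ ⟩
    det (suc n) B
      ≡⟨ det-first-column B (λ i → refl) ⟩
    M s 0 0 ℚ.* det n (λ i j → r i ℚ.* c j ℚ.* M (suc s) (toℕ i) (toℕ j))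
      ≡⟨ cong (M s 0 0 ℚ.*_) (det-scale n r c (λ i j → M (suc s) (toℕ i) (toℕ j))) ⟩
    M s 0 0 ℚ.* (∏ n r ℚ.* ∏ n c ℚ.* det n (λ i j → M (suc s) (toℕ i) (toℕ j)))
      ≡⟨ cong₂ (λ x y → x ℚ.* (∏ n r ℚ.* ∏ n c ℚ.* y)) (sym (d-first s)) (det-pivots n (suc s)) ⟩
    d s 0 ℚ.* (∏ n r ℚ.* ∏ n c ℚ.* ∏ n (λ i → d (suc s) (toℕ i)))
      ≡⟨ cong (d s 0 ℚ.*_) (begin
           ∏ n r ℚ.* ∏ n c ℚ.* ∏ n (λ i → d (suc s) (toℕ i))
             ≡⟨ cong (ℚ._* ∏ n (λ i → d (suc s) (toℕ i))) (∏-distrib-* n r c) ⟨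
           ∏ n (λ i → r i ℚ.* c i) ℚ.* ∏ n (λ i → d (suc s) (toℕ i))
             ≡⟨ ∏-distrib-* n (λ i → r i ℚ.* c i) (λ i → d (suc s) (toℕ i)) ⟨
           ∏ n (λ i → r i ℚ.* c i ℚ.* d (suc s) (toℕ i))
             ≡⟨ ∏-cong n d-step ⟩
           ∏ n (λ i → d s (suc (toℕ i))) ∎) ⟩
    ∏ (suc n) (λ i → d s (toℕ i)) ∎
    where
    A B : Matrix (suc n)
    A i j = M s (toℕ i) (toℕ j)

    v r c : Fin n → ℚ
    v i = (+ 1) ℚ./ suc (α s (toℕ i))
    r i = v i ℚ.* ℕ→ℚ (ρ s (toℕ i))
    c j = ℕ→ℚ (γ (toℕ j))

    B zero    j       = M s 0 (toℕ j)
    B (suc i) zero    = 0ℚ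
    B (suc i) (suc j) = r i ℚ.* c j ℚ.* M (suc s) (toℕ i) (toℕ j)

    divide : ∀ i {x y} → ℕ→ℚ (suc (α s (toℕ i))) ℚ.* x ≡ y → x ≡ v i ℚ.* y
    divide i {x} {y} eq = ℕ→ℚ-*-cancelˡ (suc (α s (toℕ i))) (begin
      a ℚ.* x             ≡⟨ eq ⟩
      y                   ≡⟨ ℚ.*-identityˡ y ⟨
      1ℚ ℚ.* y            ≡⟨ cong (ℚ._* y) (/-*-cancel 1 (suc (α s (toℕ i)))) ⟨
      v i ℚ.* a ℚ.* y     ≡⟨ solve 3 (λ v a y → v :* a :* y := a :* (v :* y)) refl (v i) a y ⟩
      a ℚ.* (v i ℚ.* y)   ∎)
      where a = ℕ→ℚ (suc (α s (toℕ i)))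

    d-step : ∀ i → r i ℚ.* c i ℚ.* d (suc s) (toℕ i) ≡ d s (suc (toℕ i))
    d-step i = sym (trans (divide i (d-rest s (toℕ i)))
      (solve 4 (λ v ρ γ d → v :* (ρ :* γ :* d) := v :* ρ :* γ :* d) refl
        (v i) (ℕ→ℚ (ρ s (toℕ i))) (c i) (d (suc s) (toℕ i))))

    A₀ : ∀ j → A zero j ≡ B zero j
    A₀ j = refl

    Aₛ : ∀ i j → A (suc i) j ≡ v i ℚ.* ℕ→ℚ (β s (toℕ i)) ℚ.* A (inject₁ i) j ℚ.+ B (suc i) j
    Aₛ i j rewrite toℕ-inject₁ i with j
    ... | zero = trans (divide i (M-first s (toℕ i)))
      (solve 3 (λ v b x → v :* (b :* x) := v :* b :* x :+ con 0ℚ) refl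
        (v i) (ℕ→ℚ (β s (toℕ i))) (M s (toℕ i) 0))
    ... | suc j = trans (divide i (M-rest s (toℕ i) (toℕ j)))
      (solve 6 (λ v b x p g y → v :* (b :* x :+ p :* g :* y) := v :* b :* x :+ v :* p :* g :* y) refl
        (v i) (ℕ→ℚ (β s (toℕ i))) (M s (toℕ i) (suc (toℕ j)))
        (ℕ→ℚ (ρ s (toℕ i))) (c j) (M (suc s) (toℕ i) (toℕ j)))

-- Factorials

-- The numerator of `fact-ratio 1 k` is `1 !`, that is 1. Splitting quotients of factorials into
-- `fac` and `1/fac` lets the ring solver rearrange them.
fac 1/fac : ℕ → ℚ
fac k   = ℕ→ℚ (k !)
1/fac k = fact-ratio 1 k

1/fac-*-fac : ∀ k → 1/fac k ℚ.* fac k ≡ 1ℚ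
1/fac-*-fac k = /-*-cancel 1 (k !) {{k ℕ.!≢0}}

fac-*-1/fac : ∀ k → fac k ℚ.* 1/fac k ≡ 1ℚ
fac-*-1/fac k = trans (ℚ.*-comm (fac k) (1/fac k)) (1/fac-*-fac k)

fac-suc : ∀ k → fac (suc k) ≡ ℕ→ℚ (suc k) ℚ.* fac k
fac-suc k = ℕ→ℚ-homo-* (suc k) (k !)

1/fac-suc : ∀ k → 1/fac k ≡ ℕ→ℚ (suc k) ℚ.* 1/fac (suc k)
1/fac-suc k = ℕ→ℚ-*-cancelˡ (k !) {{k ℕ.!≢0}} (begin
  fac k ℚ.* 1/fac k
    ≡⟨ ℚ.*-comm (fac k) (1/fac k) ⟩
  1/fac k ℚ.* fac k
    ≡⟨ 1/fac-*-fac k ⟩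
  1ℚ
    ≡⟨ 1/fac-*-fac (suc k) ⟨
  1/fac (suc k) ℚ.* fac (suc k)
    ≡⟨ cong (1/fac (suc k) ℚ.*_) (fac-suc k) ⟩
  1/fac (suc k) ℚ.* (ℕ→ℚ (suc k) ℚ.* fac k)
    ≡⟨ solve 3 (λ f g n → g :* (n :* f) := f :* (n :* g)) refl (fac k) (1/fac (suc k)) (ℕ→ℚ (suc k)) ⟩
  fac k ℚ.* (ℕ→ℚ (suc k) ℚ.* 1/fac (suc k)) ∎)

*-fac≡⇒≡*-1/fac : ∀ k {x y} → x ℚ.* fac k ≡ y → x ≡ y ℚ.* 1/fac k
*-fac≡⇒≡*-1/fac k {x} {y} eq = begin
  x                             ≡⟨ ℚ.*-identityʳ x ⟨
  x ℚ.* 1ℚ                      ≡⟨ cong (x ℚ.*_) (1/fac-*-fac k) ⟨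
  x ℚ.* (1/fac k ℚ.* fac k)     ≡⟨ solve 3 (λ x g f → x :* (g :* f) := x :* f :* g)
                                       refl x (1/fac k) (fac k) ⟩
  x ℚ.* fac k ℚ.* 1/fac k       ≡⟨ cong (ℚ._* 1/fac k) eq ⟩
  y ℚ.* 1/fac k                 ∎

fact-ratio≡ : ∀ a b → fact-ratio a b ≡ fac a ℚ.* 1/fac b
fact-ratio≡ a b = *-fac≡⇒≡*-1/fac b (/-*-cancel (a !) (b !) {{b ℕ.!≢0}})

-- Products over `Fin n` and over 1, ..., n

∏-one : ∀ n {f : Fin n → ℚ} → (∀ i → f i ≡ 1ℚ) → ∏ n f ≡ 1ℚ
∏-one zero    f≡1 = refl
∏-one (suc n) f≡1 = trans (cong₂ ℚ._*_ (f≡1 zero) (∏-one n (f≡1 ∘ suc))) (ℚ.*-identityˡ 1ℚ)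

-- `∏` unfolds at the front, whereas `∏[1…_]` and the induction on `m` in the product formula unfold
-- at the back.
∏-snoc : ∀ n (f : ℕ → ℚ) → ∏ (suc n) (λ i → f (toℕ i)) ≡ ∏ n (λ i → f (toℕ i)) ℚ.* f n
∏-snoc zero    f = ℚ.*-comm (f 0) 1ℚ
∏-snoc (suc n) f = trans (cong (f 0 ℚ.*_) (∏-snoc n (f ∘ suc))) (sym (ℚ.*-assoc (f 0) _ _))

-- The factor at 0 is the one that `∏[1…_]` skips; truncation in `n ∸ 1` makes the case `n = 0` an
-- empty product too.
∏≡∏[1…] : ∀ n (f : ℕ → ℚ) → f 0 ≡ 1ℚ → ∏ n (λ i → f (toℕ i)) ≡ ∏[1… n ∸ 1 ] f
∏≡∏[1…] zero          f f0 = refl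
∏≡∏[1…] (suc zero)    f f0 = trans (ℚ.*-identityʳ (f 0)) f0
∏≡∏[1…] (suc (suc n)) f f0 = trans (∏-snoc (suc n) f) (cong (ℚ._* f (suc n)) (∏≡∏[1…] (suc n) f f0))

∏[1…]-distrib-* : ∀ n (f g : ℕ → ℚ) → ∏[1… n ] (λ j → f j ℚ.* g j) ≡ ∏[1… n ] f ℚ.* ∏[1… n ] g
∏[1…]-distrib-* zero    f g = refl
∏[1…]-distrib-* (suc n) f g = trans (cong (ℚ._* (f (suc n) ℚ.* g (suc n))) (∏[1…]-distrib-* n f g))
  (solve 4 (λ p q x y → p :* q :* (x :* y) := p :* x :* (q :* y)) refl
    (∏[1… n ] f) (∏[1… n ] g) (f (suc n)) (g (suc n)))

-- The binomial determinant

-- The lowest factor is truncated to 0.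
P′-vanishes : ∀ {n k} → n ℕ.< k → n P′ k ≡ 0
P′-vanishes {n} {suc k} (ℕ.s≤s n≤k) = cong (_* (n P′ k)) (ℕ.m≤n⇒m∸n≡0 n≤k)

-- `_P′_` unfolds by its lowest factor; here the highest one is split off instead.
sucP′suc : ∀ n k → suc n P′ suc k ≡ suc n * (n P′ k)
sucP′suc n k = nP′k≡n[n∸1P′k∸1] (suc n) (suc k)

C*!≡P′ : ∀ n k → (n C k) * k ! ≡ n P′ k
C*!≡P′ n k with k ℕ.≤? n
... | no  k≰n = trans (cong (_* k !) (k>n⇒nCk≡0 (ℕ.≰⇒> k≰n))) (sym (P′-vanishes (ℕ.≰⇒> k≰n)))
... | yes k≤n = trans (cong (_* k !) (trans (nCk≡n!/k![n-k]! k≤n) (sym (nC′k≡n!/k![n-k]! k≤n))))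
                      (m/n*n≡m {{k ℕ.!≢0}} (k!∣nP′k k≤n))

-- Both sides are the falling factorial of length `suc s` at `suc (x + s)`: on the left its lowest
-- factor is split off, on the right its highest.
P′-eliminate-first : ∀ x s → suc x * (suc (x + s) P′ s) ≡ suc (x + s) * ((x + s) P′ s)
P′-eliminate-first x s = begin
  suc x * (suc (x + s) P′ s)            ≡⟨ cong (_* (suc (x + s) P′ s)) (ℕ.m+n∸n≡m (suc x) s) ⟨
  (suc (x + s) ∸ s) * (suc (x + s) P′ s) ≡⟨ sucP′suc (x + s) s ⟩
  suc (x + s) * ((x + s) P′ s)           ∎

-- Let `Q` be the falling factorial in the last term. The one on the left has the extra factor
-- `j + x + s + 2` on top of `Q`, the first one on the right has the extra factor `x - j` below it.
-- What remains is a polynomial identity.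
P′-eliminate-rest : ∀ x s j →
  suc x * ((suc j + suc (x + s)) P′ (2 * suc j + s))
    ≡ suc (x + s) * ((suc j + (x + s)) P′ (2 * suc j + s))
      + (2 + (2 * x + s)) * suc j * ((j + suc (x + s)) P′ (2 * j + suc s))
P′-eliminate-rest x s j
  rewrite ℕ.+-suc j (x + s) | ℕ.+-suc j (j + 0) | ℕ.+-suc (2 * j) s
        | sucP′suc (suc (j + (x + s))) (suc (2 * j + s))
  with x ℕ.<? j
-- Here `x - j` would be negative, but `Q` has more factors than its base, so every term is 0.
... | yes x<j
  rewrite P′-vanishes {suc (j + (x + s))} {suc (2 * j + s)} (ℕ.s≤s (ℕ.<-≤-trans
            (ℕ.+-monoʳ-< j (ℕ.+-monoˡ-< s x<j))
            (ℕ.≤-reflexive (ℕ-solve 2 (λ j s → j ⊞ (j ⊞ s) ⊜ lit 2 ⊠ j ⊞ s) refl j s))))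
  = ℕ-solve 5 (λ x a y b c → x ⊠ (a ⊠ lit 0) ⊜ y ⊠ (b ⊠ lit 0) ⊞ c ⊠ lit 0) refl
      (suc x) (suc (suc (j + (x + s)))) (suc (x + s)) (j + (x + s) ∸ (2 * j + s))
      ((2 + (2 * x + s)) * suc j)
-- With `x` written as `e + j`, the truncated difference is exactly `e`.
... | no x≮j
  rewrite sym (ℕ.m∸n+n≡m (ℕ.≮⇒≥ x≮j)) with e ← x ∸ j = begin
  suc (e + j) * (suc (suc (j + (e + j + s))) * Q)
    ≡⟨ ℕ-solve 4 (λ e j s q →
         (lit 1 ⊞ (e ⊞ j)) ⊠ ((lit 2 ⊞ (j ⊞ (e ⊞ j ⊞ s))) ⊠ q)
           ⊜ (lit 1 ⊞ (e ⊞ j ⊞ s)) ⊠ (e ⊠ q) ⊞ (lit 2 ⊞ (lit 2 ⊠ (e ⊞ j) ⊞ s)) ⊠ (lit 1 ⊞ j) ⊠ q)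
         refl e j s Q ⟩
  suc (e + j + s) * (e * Q) + R
    ≡⟨ cong (λ k → suc (e + j + s) * (k * Q) + R) (begin
         e                                 ≡⟨ ℕ.m+n∸n≡m e (2 * j + s) ⟨
         e + (2 * j + s) ∸ (2 * j + s)
           ≡⟨ cong (_∸ (2 * j + s))
                (ℕ-solve 3 (λ e j s → e ⊞ (lit 2 ⊠ j ⊞ s) ⊜ j ⊞ (e ⊞ j ⊞ s)) refl e j s) ⟩
         j + (e + j + s) ∸ (2 * j + s) ∎) ⟩
  suc (e + j + s) * ((j + (e + j + s) ∸ (2 * j + s)) * Q) + R ∎
  where
  Q = suc (j + (e + j + s)) P′ suc (2 * j + s)
  R = (2 + (2 * (e + j) + s)) * suc j * Q

-- By symmetry the binomial coefficient is `(x + j) C (2 * j)`. If `j > x`, its lower index is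
-- negative and `2 * j` exceeds `j + x`, so both sides are 0.
binom≡P′ : ∀ x j → binom (x + j) ((+ x) ℤ.- (+ j)) * (2 * j) ! ≡ (j + x) P′ (2 * j)
binom≡P′ x j with j ℕ.≤? x
... | yes j≤x = begin
  binom (x + j) ((+ x) ℤ.- (+ j)) * (2 * j) !
    ≡⟨ cong (λ z → binom (x + j) z * (2 * j) !) (trans (ℤ.m-n≡m⊖n x j) (ℤ.⊖-≥ j≤x)) ⟩
  ((x + j) C (x ∸ j)) * (2 * j) !
    ≡⟨ cong (_* (2 * j) !) (begin
         (x + j) C (x ∸ j)
           ≡⟨ nCk≡nC[n∸k] (ℕ.≤-trans (ℕ.m∸n≤m x j) (ℕ.m≤m+n x j)) ⟩
         (x + j) C (x + j ∸ (x ∸ j))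
           ≡⟨ cong ((x + j) C_) (begin
                x + j ∸ (x ∸ j)
                  ≡⟨ cong (λ y → y + j ∸ (x ∸ j)) (ℕ.m∸n+n≡m j≤x) ⟨
                x ∸ j + j + j ∸ (x ∸ j)
                  ≡⟨ cong (_∸ (x ∸ j)) (ℕ-solve 2 (λ d j → d ⊞ j ⊞ j ⊜ d ⊞ lit 2 ⊠ j) refl (x ∸ j) j) ⟩
                x ∸ j + 2 * j ∸ (x ∸ j)
                  ≡⟨ ℕ.m+n∸m≡n (x ∸ j) (2 * j) ⟩
                2 * j ∎) ⟩
         (x + j) C (2 * j) ∎) ⟩
  ((x + j) C (2 * j)) * (2 * j) !
    ≡⟨ C*!≡P′ (x + j) (2 * j) ⟩
  (x + j) P′ (2 * j)
    ≡⟨ cong (_P′ (2 * j)) (ℕ.+-comm x j) ⟩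
  (j + x) P′ (2 * j) ∎
... | no j≰x = trans
  (cong (_* (2 * j) !) (binom-vanishes (ℕ.≰⇒> j≰x)))
  (sym (P′-vanishes {j + x} (ℕ.+-monoʳ-< j
    (ℕ.<-≤-trans (ℕ.≰⇒> j≰x) (ℕ.≤-reflexive (sym (ℕ.+-identityʳ j)))))))
  where
  binom-vanishes : x ℕ.< j → binom (x + j) ((+ x) ℤ.- (+ j)) ≡ 0
  -- Once the positive number `j ∸ x` is shown as a successor, its negation matches the negative
  -- clause of `binom`.
  binom-vanishes x<j = trans
    (cong (binom (x + j)) (trans (ℤ.m-n≡m⊖n x j) (trans (ℤ.⊖-< x<j)
      (cong (λ k → ℤ.- (+ k)) (sym (ℕ.suc-pred (j ∸ x) {{ℕ.>-nonZero (ℕ.m<n⇒0<n∸m x<j)}})))))) refl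

module BinomialDeterminant (m : ℕ) where

  entry : ℕ → ℕ → ℕ → ℚ
  entry s i j = ℕ→ℚ ((j + (i + m + s)) P′ (2 * j + s))

  -- Solves the recursion `pivot-rest`, which lowers `i` and raises `s`. The falling factorial
  -- absorbs `suc (i + m)`, `fac i` supplies `suc i`, and the factorial after it supplies
  -- `2 + (2 * (i + m) + s)`. For fixed `m` the denominator depends on `i + s` only, so it is
  -- preserved, and it normalises the value at `i = 0`.
  pivot : ℕ → ℕ → ℚ
  pivot s i =
    ℕ→ℚ ((i + m + s) P′ s) ℚ.* fac i ℚ.* (fac (2 * i + (2 * m + s)) ℚ.* 1/fac (i + (2 * m + s)))

  entry-first : ∀ s i → ℕ→ℚ (suc (i + m)) ℚ.* entry s (suc i) 0 ≡ ℕ→ℚ (suc (i + m + s)) ℚ.* entry s i 0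
  entry-first s i = begin
    ℕ→ℚ (suc (i + m)) ℚ.* entry s (suc i) 0
      ≡⟨ ℕ→ℚ-homo-* (suc (i + m)) (suc (i + m + s) P′ s) ⟨
    ℕ→ℚ (suc (i + m) * (suc (i + m + s) P′ s))
      ≡⟨ cong ℕ→ℚ (P′-eliminate-first (i + m) s) ⟩
    ℕ→ℚ (suc (i + m + s) * ((i + m + s) P′ s))
      ≡⟨ ℕ→ℚ-homo-* (suc (i + m + s)) ((i + m + s) P′ s) ⟩
    ℕ→ℚ (suc (i + m + s)) ℚ.* entry s i 0 ∎

  entry-rest : ∀ s i j → ℕ→ℚ (suc (i + m)) ℚ.* entry s (suc i) (suc j)
    ≡ ℕ→ℚ (suc (i + m + s)) ℚ.* entry s i (suc j)
      ℚ.+ ℕ→ℚ (2 + (2 * (i + m) + s)) ℚ.* ℕ→ℚ (suc j) ℚ.* entry (suc s) i j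
  entry-rest s i j = begin
    ℕ→ℚ a ℚ.* ℕ→ℚ x
      ≡⟨ ℕ→ℚ-homo-* a x ⟨
    ℕ→ℚ (a * x)
      ≡⟨ cong ℕ→ℚ (P′-eliminate-rest (i + m) s j) ⟩
    ℕ→ℚ (b * y + r * suc j * ((j + suc (i + m + s)) P′ (2 * j + suc s)))
      ≡⟨ cong (λ k → ℕ→ℚ (b * y + r * suc j * ((j + k) P′ (2 * j + suc s)))) (ℕ.+-suc (i + m) s) ⟨
    ℕ→ℚ (b * y + r * suc j * z)
      ≡⟨ ℕ→ℚ-homo-+ (b * y) (r * suc j * z) ⟩
    ℕ→ℚ (b * y) ℚ.+ ℕ→ℚ (r * suc j * z)
      ≡⟨ cong₂ ℚ._+_ (ℕ→ℚ-homo-* b y)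
           (trans (ℕ→ℚ-homo-* (r * suc j) z) (cong (ℚ._* ℕ→ℚ z) (ℕ→ℚ-homo-* r (suc j)))) ⟩
    ℕ→ℚ b ℚ.* ℕ→ℚ y ℚ.+ ℕ→ℚ r ℚ.* ℕ→ℚ (suc j) ℚ.* ℕ→ℚ z ∎
    where
    a = suc (i + m)
    b = suc (i + m + s)
    r = 2 + (2 * (i + m) + s)
    x = (suc j + suc (i + m + s)) P′ (2 * suc j + s)
    y = (suc j + (i + m + s)) P′ (2 * suc j + s)
    z = (j + (i + m + suc s)) P′ (2 * j + suc s)

  pivot-first : ∀ s → pivot s 0 ≡ entry s 0 0
  pivot-first s = trans (cong (entry s 0 0 ℚ.* 1ℚ ℚ.*_) (fac-*-1/fac (2 * m + s)))
    (solve 1 (λ x → x :* con 1ℚ :* con 1ℚ := x) refl (entry s 0 0))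

  pivot-rest : ∀ s i → ℕ→ℚ (suc (i + m)) ℚ.* pivot s (suc i)
    ≡ ℕ→ℚ (2 + (2 * (i + m) + s)) ℚ.* ℕ→ℚ (suc i) ℚ.* pivot (suc s) i
  pivot-rest s i = begin
    ℕ→ℚ (suc (i + m)) ℚ.* (ℕ→ℚ p ℚ.* fac (suc i) ℚ.* (fac (2 * suc i + w) ℚ.* 1/fac (suc u)))
      ≡⟨ cong (λ x → ℕ→ℚ (suc (i + m)) ℚ.* (ℕ→ℚ p ℚ.* fac (suc i) ℚ.* (x ℚ.* 1/fac (suc u))))
           (trans (cong fac 2i+2+w) (fac-suc (suc v))) ⟩
    ℕ→ℚ (suc (i + m)) ℚ.* (ℕ→ℚ p ℚ.* fac (suc i) ℚ.* (ℕ→ℚ (suc (suc v)) ℚ.* fac (suc v) ℚ.* 1/fac (suc u)))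
      ≡⟨ cong₂ (λ x r → ℕ→ℚ (suc (i + m)) ℚ.* (ℕ→ℚ p ℚ.* x ℚ.* (ℕ→ℚ r ℚ.* fac (suc v) ℚ.* 1/fac (suc u))))
           (fac-suc i) 2+v ⟩
    ℕ→ℚ (suc (i + m)) ℚ.* (ℕ→ℚ p ℚ.* (ℕ→ℚ (suc i) ℚ.* fac i) ℚ.* (ℕ→ℚ ρ ℚ.* fac (suc v) ℚ.* 1/fac (suc u)))
      ≡⟨ solve 7 (λ a p k f r g h →
           a :* (p :* (k :* f) :* (r :* g :* h)) := r :* k :* (a :* p :* f :* (g :* h)))
           refl (ℕ→ℚ (suc (i + m))) (ℕ→ℚ p) (ℕ→ℚ (suc i)) (fac i) (ℕ→ℚ ρ) (fac (suc v)) (1/fac (suc u)) ⟩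
    ℕ→ℚ ρ ℚ.* ℕ→ℚ (suc i) ℚ.* (ℕ→ℚ (suc (i + m)) ℚ.* ℕ→ℚ p ℚ.* fac i ℚ.* (fac (suc v) ℚ.* 1/fac (suc u)))
      ≡⟨ cong (λ x → ℕ→ℚ ρ ℚ.* ℕ→ℚ (suc i) ℚ.* (x ℚ.* fac i ℚ.* (fac (suc v) ℚ.* 1/fac (suc u))))
           (trans (sym (ℕ→ℚ-homo-* (suc (i + m)) p)) (cong ℕ→ℚ fall)) ⟩
    ℕ→ℚ ρ ℚ.* ℕ→ℚ (suc i) ℚ.* (ℕ→ℚ ((i + m + suc s) P′ suc s) ℚ.* fac i ℚ.* (fac (suc v) ℚ.* 1/fac (suc u)))
      ≡⟨ cong₂ (λ x y → ℕ→ℚ ρ ℚ.* ℕ→ℚ (suc i) ℚ.*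
             (ℕ→ℚ ((i + m + suc s) P′ suc s) ℚ.* fac i ℚ.* (fac x ℚ.* 1/fac y)))
           (ℕ-solve 3 (λ i m s →
             lit 1 ⊞ (lit 2 ⊠ i ⊞ (lit 2 ⊠ m ⊞ s)) ⊜ lit 2 ⊠ i ⊞ (lit 2 ⊠ m ⊞ (lit 1 ⊞ s))) refl i m s)
           (ℕ-solve 3 (λ i m s →
             lit 1 ⊞ (i ⊞ (lit 2 ⊠ m ⊞ s)) ⊜ i ⊞ (lit 2 ⊠ m ⊞ (lit 1 ⊞ s))) refl i m s) ⟩
    ℕ→ℚ ρ ℚ.* ℕ→ℚ (suc i) ℚ.* pivot (suc s) i ∎
    where
    w = 2 * m + s
    u = i + w
    v = 2 * i + w
    p = suc (i + m + s) P′ s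
    ρ = 2 + (2 * (i + m) + s)
    2i+2+w : 2 * suc i + w ≡ suc (suc v)
    2i+2+w = ℕ-solve 2 (λ i w → lit 2 ⊠ (lit 1 ⊞ i) ⊞ w ⊜ lit 2 ⊞ (lit 2 ⊠ i ⊞ w)) refl i w
    2+v : suc (suc v) ≡ ρ
    2+v = ℕ-solve 3 (λ i m s →
      lit 2 ⊞ (lit 2 ⊠ i ⊞ (lit 2 ⊠ m ⊞ s)) ⊜ lit 2 ⊞ (lit 2 ⊠ (i ⊞ m) ⊞ s)) refl i m s
    fall : suc (i + m) * p ≡ (i + m + suc s) P′ suc s
    fall = begin
      suc (i + m) * p                  ≡⟨ cong (_* p) (ℕ.m+n∸n≡m (suc (i + m)) s) ⟨
      suc (i + m + s) P′ suc s         ≡⟨ cong (_P′ suc s) (ℕ.+-suc (i + m) s) ⟨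
      (i + m + suc s) P′ suc s         ∎

  open Elimination entry (λ s i → i + m) (λ s i → suc (i + m + s)) (λ s i → 2 + (2 * (i + m) + s)) suc pivot
    entry-first entry-rest pivot-first pivot-rest

  det-binom : ∀ n →
    det n (λ i j → ℕ→ℚ (binom (toℕ i + toℕ j + m) ((+ (toℕ i + m)) ℤ.- (+ toℕ j))))
      ≡ ∏ n (λ i → fact-ratio (toℕ i) (2 * toℕ i) ℚ.* fact-ratio (2 * m + 2 * toℕ i) (2 * m + toℕ i))
  det-binom n = begin
    det n (λ i j → ℕ→ℚ (binom (toℕ i + toℕ j + m) ((+ (toℕ i + m)) ℤ.- (+ toℕ j))))
      -- The factor `1/fac (2 * j)` depends on the column only; the row factor `1ℚ` brings the entry
      -- into the form of `det-scale`.
      ≡⟨ det-cong n (λ i j → entry≡ (toℕ i) (toℕ j)) ⟩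
    det n (λ i j → 1ℚ ℚ.* 1/fac (2 * toℕ j) ℚ.* entry 0 (toℕ i) (toℕ j))
      ≡⟨ det-scale n (λ _ → 1ℚ) (λ j → 1/fac (2 * toℕ j)) (λ i j → entry 0 (toℕ i) (toℕ j)) ⟩
    ∏ n (λ _ → 1ℚ) ℚ.* D ℚ.* det n (λ i j → entry 0 (toℕ i) (toℕ j))
      ≡⟨ cong₂ (λ x y → x ℚ.* D ℚ.* y) (∏-one n (λ _ → refl)) (det-pivots n 0) ⟩
    1ℚ ℚ.* D ℚ.* ∏ n (λ i → pivot 0 (toℕ i))
      ≡⟨ cong (ℚ._* ∏ n (λ i → pivot 0 (toℕ i))) (ℚ.*-identityˡ D) ⟩
    D ℚ.* ∏ n (λ i → pivot 0 (toℕ i))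
      ≡⟨ ∏-distrib-* n (λ j → 1/fac (2 * toℕ j)) (λ i → pivot 0 (toℕ i)) ⟨
    ∏ n (λ i → 1/fac (2 * toℕ i) ℚ.* pivot 0 (toℕ i))
      ≡⟨ ∏-cong n (λ i → pivot≡ (toℕ i)) ⟩
    ∏ n (λ i → fact-ratio (toℕ i) (2 * toℕ i) ℚ.* fact-ratio (2 * m + 2 * toℕ i) (2 * m + toℕ i)) ∎
    where
    D = ∏ n (λ j → 1/fac (2 * toℕ j))

    entry≡ : ∀ i j → ℕ→ℚ (binom (i + j + m) ((+ (i + m)) ℤ.- (+ j))) ≡ 1ℚ ℚ.* 1/fac (2 * j) ℚ.* entry 0 i j
    entry≡ i j = begin
      ℕ→ℚ (binom (i + j + m) ((+ (i + m)) ℤ.- (+ j)))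
        ≡⟨ cong (λ a → ℕ→ℚ (binom a ((+ (i + m)) ℤ.- (+ j))))
             (ℕ-solve 3 (λ i j m → i ⊞ j ⊞ m ⊜ i ⊞ m ⊞ j) refl i j m) ⟩
      ℕ→ℚ c
        ≡⟨ *-fac≡⇒≡*-1/fac (2 * j) (trans (sym (ℕ→ℚ-homo-* c ((2 * j) !)))
             (cong ℕ→ℚ (binom≡P′ (i + m) j))) ⟩
      ℕ→ℚ ((j + (i + m)) P′ (2 * j)) ℚ.* 1/fac (2 * j)
        ≡⟨ cong₂ (λ x k → ℕ→ℚ ((j + x) P′ k) ℚ.* 1/fac (2 * j))
             (sym (ℕ.+-identityʳ (i + m))) (sym (ℕ.+-identityʳ (2 * j))) ⟩
      entry 0 i j ℚ.* 1/fac (2 * j)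
        ≡⟨ solve 2 (λ e f → e :* f := con 1ℚ :* f :* e) refl (entry 0 i j) (1/fac (2 * j)) ⟩
      1ℚ ℚ.* 1/fac (2 * j) ℚ.* entry 0 i j ∎
      where c = binom (i + m + j) ((+ (i + m)) ℤ.- (+ j))

    pivot≡ : ∀ i → 1/fac (2 * i) ℚ.* pivot 0 i
      ≡ fact-ratio i (2 * i) ℚ.* fact-ratio (2 * m + 2 * i) (2 * m + i)
    pivot≡ i = begin
      1/fac (2 * i) ℚ.* (1ℚ ℚ.* fac i ℚ.* (fac (2 * i + (2 * m + 0)) ℚ.* 1/fac (i + (2 * m + 0))))
        ≡⟨ cong₂ (λ x y → 1/fac (2 * i) ℚ.* (1ℚ ℚ.* fac i ℚ.* (fac x ℚ.* 1/fac y)))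
             (ℕ-solve 2 (λ i m → lit 2 ⊠ i ⊞ (lit 2 ⊠ m ⊞ lit 0) ⊜ lit 2 ⊠ m ⊞ lit 2 ⊠ i) refl i m)
             (ℕ-solve 2 (λ i m → i ⊞ (lit 2 ⊠ m ⊞ lit 0) ⊜ lit 2 ⊠ m ⊞ i) refl i m) ⟩
      1/fac (2 * i) ℚ.* (1ℚ ℚ.* fac i ℚ.* (fac (2 * m + 2 * i) ℚ.* 1/fac (2 * m + i)))
        ≡⟨ solve 4 (λ a b c d → a :* (con 1ℚ :* b :* (c :* d)) := b :* a :* (c :* d)) refl
             (1/fac (2 * i)) (fac i) (fac (2 * m + 2 * i)) (1/fac (2 * m + i)) ⟩
      fac i ℚ.* 1/fac (2 * i) ℚ.* (fac (2 * m + 2 * i) ℚ.* 1/fac (2 * m + i))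
        ≡⟨ cong₂ ℚ._*_ (fact-ratio≡ i (2 * i)) (fact-ratio≡ (2 * m + 2 * i) (2 * m + i)) ⟨
      fact-ratio i (2 * i) ℚ.* fact-ratio (2 * m + 2 * i) (2 * m + i) ∎

-- The Catalan determinant

-- Central binomial coefficients for `t = 0`, Catalan numbers for `t = 1`.
moment : ℕ → ℕ → ℚ
moment t l = fac (2 * l) ℚ.* (1/fac l ℚ.* 1/fac (l + t))

-- Together with `moment-suc`, expresses two consecutive moments through the same
-- `moment (suc t) l`, so that their ratio can be used by cross-multiplication.
moment-raise : ∀ t l → moment t l ≡ ℕ→ℚ (suc (l + t)) ℚ.* moment (suc t) l
moment-raise t l = begin
  fac (2 * l) ℚ.* (1/fac l ℚ.* 1/fac (l + t))
    ≡⟨ cong (λ x → fac (2 * l) ℚ.* (1/fac l ℚ.* x)) (1/fac-suc (l + t)) ⟩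
  fac (2 * l) ℚ.* (1/fac l ℚ.* (ℕ→ℚ (suc (l + t)) ℚ.* 1/fac (suc (l + t))))
    ≡⟨ solve 4 (λ a b c d → a :* (b :* (c :* d)) := c :* (a :* (b :* d))) refl
         (fac (2 * l)) (1/fac l) (ℕ→ℚ (suc (l + t))) (1/fac (suc (l + t))) ⟩
  ℕ→ℚ (suc (l + t)) ℚ.* (fac (2 * l) ℚ.* (1/fac l ℚ.* 1/fac (suc (l + t))))
    ≡⟨ cong (λ k → ℕ→ℚ (suc (l + t)) ℚ.* (fac (2 * l) ℚ.* (1/fac l ℚ.* 1/fac k))) (ℕ.+-suc l t) ⟨
  ℕ→ℚ (suc (l + t)) ℚ.* moment (suc t) l ∎

fac-double-suc : ∀ l → fac (2 * suc l) ≡ ℕ→ℚ (2 * suc (2 * l)) ℚ.* ℕ→ℚ (suc l) ℚ.* fac (2 * l)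
fac-double-suc l = begin
  fac (2 * suc l)
    ≡⟨ cong fac (ℕ.+-suc (suc l) (l + 0)) ⟩
  ℕ→ℚ (suc (suc (2 * l)) * (suc (2 * l) * (2 * l) !))
    ≡⟨ cong ℕ→ℚ (ℕ-solve 2 (λ l f → (lit 2 ⊞ lit 2 ⊠ l) ⊠ ((lit 1 ⊞ lit 2 ⊠ l) ⊠ f)
         ⊜ (lit 2 ⊠ (lit 1 ⊞ lit 2 ⊠ l)) ⊠ (lit 1 ⊞ l) ⊠ f) refl l ((2 * l) !)) ⟩
  ℕ→ℚ (2 * suc (2 * l) * suc l * (2 * l) !)
    ≡⟨ ℕ→ℚ-homo-* (2 * suc (2 * l) * suc l) ((2 * l) !) ⟩
  ℕ→ℚ (2 * suc (2 * l) * suc l) ℚ.* fac (2 * l)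
    ≡⟨ cong (ℚ._* fac (2 * l)) (ℕ→ℚ-homo-* (2 * suc (2 * l)) (suc l)) ⟩
  ℕ→ℚ (2 * suc (2 * l)) ℚ.* ℕ→ℚ (suc l) ℚ.* fac (2 * l) ∎

moment-suc : ∀ t l → moment t (suc l) ≡ ℕ→ℚ (2 * suc (2 * l)) ℚ.* moment (suc t) l
moment-suc t l = begin
  fac (2 * suc l) ℚ.* (1/fac (suc l) ℚ.* 1/fac (suc l + t))
    ≡⟨ cong₂ (λ x k → x ℚ.* (1/fac (suc l) ℚ.* 1/fac k)) (fac-double-suc l) (sym (ℕ.+-suc l t)) ⟩
  c ℚ.* ℕ→ℚ (suc l) ℚ.* fac (2 * l) ℚ.* (1/fac (suc l) ℚ.* 1/fac (l + suc t))
    ≡⟨ solve 5 (λ c k f g h → c :* k :* f :* (g :* h) := c :* (f :* (k :* g :* h))) refl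
         c (ℕ→ℚ (suc l)) (fac (2 * l)) (1/fac (suc l)) (1/fac (l + suc t)) ⟩
  c ℚ.* (fac (2 * l) ℚ.* (ℕ→ℚ (suc l) ℚ.* 1/fac (suc l) ℚ.* 1/fac (l + suc t)))
    ≡⟨ cong (λ x → c ℚ.* (fac (2 * l) ℚ.* (x ℚ.* 1/fac (l + suc t)))) (1/fac-suc l) ⟨
  c ℚ.* moment (suc t) l ∎
  where c = ℕ→ℚ (2 * suc (2 * l))

-- The denominator `suc l` turns one of the two factors `l !` below the central binomial coefficient
-- into `(suc l) !`.
catalan≡moment : ∀ l → catalan l ≡ moment 1 l
catalan≡moment l = ℕ→ℚ-*-cancelˡ (suc l) (begin
  ℕ→ℚ (suc l) ℚ.* catalan l
    ≡⟨ ℚ.*-comm (ℕ→ℚ (suc l)) (catalan l) ⟩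
  catalan l ℚ.* ℕ→ℚ (suc l)
    ≡⟨ /-*-cancel ((2 * l) C l) (suc l) ⟩
  ℕ→ℚ ((2 * l) C l)
    ≡⟨ *-fac≡⇒≡*-1/fac l (*-fac≡⇒≡*-1/fac l central) ⟩
  fac (2 * l) ℚ.* 1/fac l ℚ.* 1/fac l
    ≡⟨ cong (fac (2 * l) ℚ.* 1/fac l ℚ.*_) (1/fac-suc l) ⟩
  fac (2 * l) ℚ.* 1/fac l ℚ.* (ℕ→ℚ (suc l) ℚ.* 1/fac (suc l))
    ≡⟨ solve 4 (λ a b c d → a :* b :* (c :* d) := c :* (a :* (b :* d))) refl
         (fac (2 * l)) (1/fac l) (ℕ→ℚ (suc l)) (1/fac (suc l)) ⟩
  ℕ→ℚ (suc l) ℚ.* (fac (2 * l) ℚ.* (1/fac l ℚ.* 1/fac (suc l)))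
    ≡⟨ cong (λ k → ℕ→ℚ (suc l) ℚ.* (fac (2 * l) ℚ.* (1/fac l ℚ.* 1/fac k))) (ℕ.+-comm 1 l) ⟩
  ℕ→ℚ (suc l) ℚ.* moment 1 l ∎)
  where
  l≤2l : l ℕ.≤ 2 * l
  l≤2l = ℕ.m≤m+n l (l + 0)
  C*!*! : ((2 * l) C l) * (l ! * (2 * l ∸ l) !) ≡ (2 * l) !
  C*!*! = trans (cong (_* (l ! * (2 * l ∸ l) !)) (nCk≡n!/k![n-k]! l≤2l))
    (m/n*n≡m {{ℕ._!*_!≢0 l (2 * l ∸ l)}} (k![n∸k]!∣n! l≤2l))
  central : ℕ→ℚ ((2 * l) C l) ℚ.* fac l ℚ.* fac l ≡ fac (2 * l)
  central = begin
    ℕ→ℚ ((2 * l) C l) ℚ.* fac l ℚ.* fac l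
      ≡⟨ ℚ.*-assoc (ℕ→ℚ ((2 * l) C l)) (fac l) (fac l) ⟩
    ℕ→ℚ ((2 * l) C l) ℚ.* (fac l ℚ.* fac l)
      ≡⟨ cong (ℕ→ℚ ((2 * l) C l) ℚ.*_) (ℕ→ℚ-homo-* (l !) (l !)) ⟨
    ℕ→ℚ ((2 * l) C l) ℚ.* ℕ→ℚ (l ! * l !)
      ≡⟨ ℕ→ℚ-homo-* ((2 * l) C l) (l ! * l !) ⟨
    ℕ→ℚ (((2 * l) C l) * (l ! * l !))
      ≡⟨ cong (λ k → ℕ→ℚ (((2 * l) C l) * (l ! * k !))) (trans (ℕ.m+n∸m≡n l (l + 0)) (ℕ.+-identityʳ l)) ⟨
    ℕ→ℚ (((2 * l) C l) * (l ! * (2 * l ∸ l) !))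
      ≡⟨ cong ℕ→ℚ C*!*! ⟩
    fac (2 * l) ∎

module CatalanDeterminant (n : ℕ) where

  entry : ℕ → ℕ → ℕ → ℚ
  entry t i j = moment (suc t) (j + (i + (t + n)))

  α β ρ : ℕ → ℕ → ℕ
  α t i = i + (t + n) + suc t
  β t i = 2 * suc (2 * (i + (t + n)))
  ρ t i = 2 + 4 * suc t

  entry-first : ∀ t i → ℕ→ℚ (suc (α t i)) ℚ.* entry t (suc i) 0 ≡ ℕ→ℚ (β t i) ℚ.* entry t i 0
  entry-first t i = begin
    ℕ→ℚ (suc (α t i)) ℚ.* moment (suc t) (suc l)
      ≡⟨ cong (ℕ→ℚ (suc (α t i)) ℚ.*_) (moment-suc (suc t) l) ⟩
    ℕ→ℚ (suc (α t i)) ℚ.* (ℕ→ℚ (β t i) ℚ.* moment (suc (suc t)) l)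
      ≡⟨ solve 3 (λ a b x → a :* (b :* x) := b :* (a :* x)) refl
           (ℕ→ℚ (suc (α t i))) (ℕ→ℚ (β t i)) (moment (suc (suc t)) l) ⟩
    ℕ→ℚ (β t i) ℚ.* (ℕ→ℚ (suc (α t i)) ℚ.* moment (suc (suc t)) l)
      ≡⟨ cong (ℕ→ℚ (β t i) ℚ.*_) (moment-raise (suc t) l) ⟨
    ℕ→ℚ (β t i) ℚ.* moment (suc t) l ∎
    where l = i + (t + n)

  -- With `k = suc (j + l)`, both entries of column `suc j` are multiples of
  -- `moment (suc (suc t)) k`. The resulting difference of coefficients vanishes for `k = l`; it is
  -- `ρ t i` times `k - l`, which is `suc j`.
  entry-rest : ∀ t i j → ℕ→ℚ (suc (α t i)) ℚ.* entry t (suc i) (suc j)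
    ≡ ℕ→ℚ (β t i) ℚ.* entry t i (suc j) ℚ.+ ℕ→ℚ (ρ t i) ℚ.* ℕ→ℚ (suc j) ℚ.* entry (suc t) i j
  entry-rest t i j = begin
    ℕ→ℚ a ℚ.* moment (suc t) (suc (j + suc l))
      ≡⟨ cong (λ k → ℕ→ℚ a ℚ.* moment (suc t) (suc k)) (ℕ.+-suc j l) ⟩
    ℕ→ℚ a ℚ.* moment (suc t) (suc k)
      ≡⟨ cong (ℕ→ℚ a ℚ.*_) (moment-suc (suc t) k) ⟩
    ℕ→ℚ a ℚ.* (ℕ→ℚ (2 * suc (2 * k)) ℚ.* x)
      ≡⟨ ℚ.*-assoc (ℕ→ℚ a) (ℕ→ℚ (2 * suc (2 * k))) x ⟨
    ℕ→ℚ a ℚ.* ℕ→ℚ (2 * suc (2 * k)) ℚ.* x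
      ≡⟨ cong (ℚ._* x) coefficients ⟩
    (ℕ→ℚ b ℚ.* ℕ→ℚ (suc (k + suc t)) ℚ.+ ℕ→ℚ (ρ t i) ℚ.* ℕ→ℚ (suc j)) ℚ.* x
      ≡⟨ solve 5 (λ b c r s x → (b :* c :+ r :* s) :* x := b :* (c :* x) :+ r :* s :* x) refl
           (ℕ→ℚ b) (ℕ→ℚ (suc (k + suc t))) (ℕ→ℚ (ρ t i)) (ℕ→ℚ (suc j)) x ⟩
    ℕ→ℚ b ℚ.* (ℕ→ℚ (suc (k + suc t)) ℚ.* x) ℚ.+ ℕ→ℚ (ρ t i) ℚ.* ℕ→ℚ (suc j) ℚ.* x
      ≡⟨ cong₂ (λ y k → ℕ→ℚ b ℚ.* y ℚ.+ ℕ→ℚ (ρ t i) ℚ.* ℕ→ℚ (suc j) ℚ.* moment (suc (suc t)) k)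
           (sym (moment-raise (suc t) k))
           (trans (sym (ℕ.+-suc j l)) (cong (λ k → j + k) (sym (ℕ.+-suc i (t + n))))) ⟩
    ℕ→ℚ b ℚ.* entry t i (suc j) ℚ.+ ℕ→ℚ (ρ t i) ℚ.* ℕ→ℚ (suc j) ℚ.* entry (suc t) i j ∎
    where
    a = suc (α t i)
    b = β t i
    l = i + (t + n)
    k = suc (j + l)
    x = moment (suc (suc t)) k
    coefficients : ℕ→ℚ a ℚ.* ℕ→ℚ (2 * suc (2 * k))
      ≡ ℕ→ℚ b ℚ.* ℕ→ℚ (suc (k + suc t)) ℚ.+ ℕ→ℚ (ρ t i) ℚ.* ℕ→ℚ (suc j)
    coefficients = begin
      ℕ→ℚ a ℚ.* ℕ→ℚ (2 * suc (2 * k))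
        ≡⟨ ℕ→ℚ-homo-* a (2 * suc (2 * k)) ⟨
      ℕ→ℚ (a * (2 * suc (2 * k)))
        ≡⟨ cong ℕ→ℚ (ℕ-solve 3 (λ l t j →
             (lit 1 ⊞ (l ⊞ (lit 1 ⊞ t))) ⊠ (lit 2 ⊠ (lit 1 ⊞ lit 2 ⊠ (lit 1 ⊞ (j ⊞ l))))
               ⊜ (lit 2 ⊠ (lit 1 ⊞ lit 2 ⊠ l)) ⊠ (lit 1 ⊞ ((lit 1 ⊞ (j ⊞ l)) ⊞ (lit 1 ⊞ t)))
                 ⊞ (lit 2 ⊞ lit 4 ⊠ (lit 1 ⊞ t)) ⊠ (lit 1 ⊞ j)) refl l t j) ⟩
      ℕ→ℚ (b * suc (k + suc t) + ρ t i * suc j)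
        ≡⟨ ℕ→ℚ-homo-+ (b * suc (k + suc t)) (ρ t i * suc j) ⟩
      ℕ→ℚ (b * suc (k + suc t)) ℚ.+ ℕ→ℚ (ρ t i * suc j)
        ≡⟨ cong₂ ℚ._+_ (ℕ→ℚ-homo-* b (suc (k + suc t))) (ℕ→ℚ-homo-* (ρ t i) (suc j)) ⟩
      ℕ→ℚ b ℚ.* ℕ→ℚ (suc (k + suc t)) ℚ.+ ℕ→ℚ (ρ t i) ℚ.* ℕ→ℚ (suc j) ∎

  -- Collects the factors of the pivot that depend on `t` and `i` only through `t + i`, which the
  -- recursion `pivot-rest` preserves.
  weight : ℕ → ℕ → ℕ → ℚ
  weight a b c = fac (2 * a) ℚ.* 1/fac a ℚ.* (fac (2 * b) ℚ.* 1/fac b) ℚ.* (1/fac c ℚ.* 1/fac (suc c))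

  -- In the recursion `fac i` supplies `suc i`, the quotient of `fac (suc t)` by `fac (2 * suc t)`
  -- supplies `ρ t i`, and `fac (i + (t + n) + t)` absorbs `suc (α t i)`. The `weight` is determined
  -- by the value at `i = 0`.
  pivot : ℕ → ℕ → ℚ
  pivot t i = fac i ℚ.* (fac (suc t) ℚ.* 1/fac (2 * suc t)) ℚ.* fac (i + (t + n) + t)
    ℚ.* weight (i + suc t) (i + (t + n)) (i + (i + (t + n) + t))

  pivot-first : ∀ t → pivot t 0 ≡ entry t 0 0
  pivot-first t = begin
    1ℚ ℚ.* (fac T ℚ.* 1/fac (2 * T)) ℚ.* fac c ℚ.*
      (fac (2 * T) ℚ.* 1/fac T ℚ.* (fac (2 * b) ℚ.* 1/fac b) ℚ.* (1/fac c ℚ.* 1/fac (suc c)))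
      ≡⟨ solve 9 (λ x x′ y y′ z z′ u v w →
           con 1ℚ :* (x :* y′) :* z :* (y :* x′ :* (u :* v) :* (z′ :* w))
             := (x :* x′) :* (y :* y′) :* (z :* z′) :* (u :* (v :* w))) refl
           (fac T) (1/fac T) (fac (2 * T)) (1/fac (2 * T)) (fac c) (1/fac c)
           (fac (2 * b)) (1/fac b) (1/fac (suc c)) ⟩
    fac T ℚ.* 1/fac T ℚ.* (fac (2 * T) ℚ.* 1/fac (2 * T)) ℚ.* (fac c ℚ.* 1/fac c) ℚ.* y
      ≡⟨ cong₂ (λ p q → p ℚ.* q ℚ.* y)
           (cong₂ ℚ._*_ (fac-*-1/fac T) (fac-*-1/fac (2 * T))) (fac-*-1/fac c) ⟩
    1ℚ ℚ.* 1ℚ ℚ.* 1ℚ ℚ.* y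
      ≡⟨ solve 1 (λ y → con 1ℚ :* con 1ℚ :* con 1ℚ :* y := y) refl y ⟩
    y
      ≡⟨ cong (λ k → fac (2 * b) ℚ.* (1/fac b ℚ.* 1/fac k)) (ℕ.+-suc b t) ⟨
    entry t 0 0 ∎
    where
    T = suc t
    b = t + n
    c = t + n + t
    y = fac (2 * b) ℚ.* (1/fac b ℚ.* 1/fac (suc c))

  pivot-rest : ∀ t i → ℕ→ℚ (suc (α t i)) ℚ.* pivot t (suc i)
    ≡ ℕ→ℚ (ρ t i) ℚ.* ℕ→ℚ (suc i) ℚ.* pivot (suc t) i
  pivot-rest t i = begin
    ℕ→ℚ (suc (α t i)) ℚ.* (fac (suc i) ℚ.* h T ℚ.* fac (suc e) ℚ.* w)
      ≡⟨ cong₂ (λ x y → ℕ→ℚ (suc (α t i)) ℚ.* (x ℚ.* y ℚ.* fac (suc e) ℚ.* w)) (fac-suc i) h-step ⟩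
    ℕ→ℚ (suc (α t i)) ℚ.* (ℕ→ℚ (suc i) ℚ.* fac i ℚ.* (ℕ→ℚ (ρ t i) ℚ.* h (suc T)) ℚ.* fac (suc e) ℚ.* w)
      ≡⟨ solve 7 (λ a k f r h e w →
           a :* (k :* f :* (r :* h) :* e :* w) := r :* k :* (f :* h :* (a :* e) :* w)) refl
           (ℕ→ℚ (suc (α t i))) (ℕ→ℚ (suc i)) (fac i) (ℕ→ℚ (ρ t i)) (h (suc T)) (fac (suc e)) w ⟩
    ℕ→ℚ (ρ t i) ℚ.* ℕ→ℚ (suc i) ℚ.* (fac i ℚ.* h (suc T) ℚ.* (ℕ→ℚ (suc (α t i)) ℚ.* fac (suc e)) ℚ.* w)
      ≡⟨ cong₂ (λ x y → ℕ→ℚ (ρ t i) ℚ.* ℕ→ℚ (suc i) ℚ.* (fac i ℚ.* h (suc T) ℚ.* x ℚ.* y)) e-step w-step ⟩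
    ℕ→ℚ (ρ t i) ℚ.* ℕ→ℚ (suc i) ℚ.* pivot (suc t) i ∎
    where
    T = suc t
    e = i + (t + n) + t
    w = weight (suc i + T) (suc i + (t + n)) (suc i + suc e)
    h : ℕ → ℚ
    h k = fac k ℚ.* 1/fac (2 * k)

    h-step : h T ≡ ℕ→ℚ (ρ t i) ℚ.* h (suc T)
    h-step = begin
      fac T ℚ.* 1/fac (2 * T)
        ≡⟨ cong (fac T ℚ.*_) (trans (1/fac-suc (2 * T))
             (cong (ℕ→ℚ (suc (2 * T)) ℚ.*_) (1/fac-suc (suc (2 * T))))) ⟩
      fac T ℚ.* (ℕ→ℚ (suc (2 * T)) ℚ.* (ℕ→ℚ (2 + 2 * T) ℚ.* 1/fac (2 + 2 * T)))
        ≡⟨ solve 4 (λ f a b g → f :* (a :* (b :* g)) := a :* b :* (f :* g)) refl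
             (fac T) (ℕ→ℚ (suc (2 * T))) (ℕ→ℚ (2 + 2 * T)) (1/fac (2 + 2 * T)) ⟩
      ℕ→ℚ (suc (2 * T)) ℚ.* ℕ→ℚ (2 + 2 * T) ℚ.* (fac T ℚ.* 1/fac (2 + 2 * T))
        ≡⟨ cong₂ (λ x k → x ℚ.* (fac T ℚ.* 1/fac k)) factor (sym (ℕ.+-suc (suc T) (T + 0))) ⟩
      ℕ→ℚ (ρ t i) ℚ.* ℕ→ℚ (suc T) ℚ.* (fac T ℚ.* 1/fac (2 * suc T))
        ≡⟨ solve 4 (λ r k f g → r :* k :* (f :* g) := r :* (k :* f :* g)) refl
             (ℕ→ℚ (ρ t i)) (ℕ→ℚ (suc T)) (fac T) (1/fac (2 * suc T)) ⟩
      ℕ→ℚ (ρ t i) ℚ.* (ℕ→ℚ (suc T) ℚ.* fac T ℚ.* 1/fac (2 * suc T))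
        ≡⟨ cong (λ x → ℕ→ℚ (ρ t i) ℚ.* (x ℚ.* 1/fac (2 * suc T))) (fac-suc T) ⟨
      ℕ→ℚ (ρ t i) ℚ.* h (suc T) ∎
      where
      factor : ℕ→ℚ (suc (2 * T)) ℚ.* ℕ→ℚ (2 + 2 * T) ≡ ℕ→ℚ (ρ t i) ℚ.* ℕ→ℚ (suc T)
      factor = begin
        ℕ→ℚ (suc (2 * T)) ℚ.* ℕ→ℚ (2 + 2 * T)
          ≡⟨ ℕ→ℚ-homo-* (suc (2 * T)) (2 + 2 * T) ⟨
        ℕ→ℚ (suc (2 * T) * (2 + 2 * T))
          ≡⟨ cong ℕ→ℚ (ℕ-solve 1 (λ T → (lit 1 ⊞ lit 2 ⊠ T) ⊠ (lit 2 ⊞ lit 2 ⊠ T)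
               ⊜ (lit 2 ⊞ lit 4 ⊠ T) ⊠ (lit 1 ⊞ T)) refl T) ⟩
        ℕ→ℚ (ρ t i * suc T)
          ≡⟨ ℕ→ℚ-homo-* (ρ t i) (suc T) ⟩
        ℕ→ℚ (ρ t i) ℚ.* ℕ→ℚ (suc T) ∎

    e+2 : suc (suc e) ≡ i + (suc t + n) + suc t
    e+2 = ℕ-solve 3 (λ i t n → lit 2 ⊞ (i ⊞ (t ⊞ n) ⊞ t) ⊜ i ⊞ (lit 1 ⊞ t ⊞ n) ⊞ (lit 1 ⊞ t)) refl i t n

    e-step : ℕ→ℚ (suc (α t i)) ℚ.* fac (suc e) ≡ fac (i + (suc t + n) + suc t)
    e-step = begin
      ℕ→ℚ (suc (α t i)) ℚ.* fac (suc e)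
        ≡⟨ cong (λ k → ℕ→ℚ (suc k) ℚ.* fac (suc e)) (ℕ.+-suc (i + (t + n)) t) ⟩
      ℕ→ℚ (suc (suc e)) ℚ.* fac (suc e)
        ≡⟨ fac-suc (suc e) ⟨
      fac (suc (suc e))
        ≡⟨ cong fac e+2 ⟩
      fac (i + (suc t + n) + suc t) ∎

    w-step : w ≡ weight (i + suc T) (i + (suc t + n)) (i + (i + (suc t + n) + suc t))
    w-step = begin
      weight (suc (i + T)) (suc (i + (t + n))) (suc (i + suc e))
        ≡⟨ cong₂ (λ a b → weight a b (suc (i + suc e))) (sym (ℕ.+-suc i T)) (sym (ℕ.+-suc i (t + n))) ⟩
      weight (i + suc T) (i + (suc t + n)) (suc (i + suc e))
        ≡⟨ cong (weight (i + suc T) (i + (suc t + n)))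
             (trans (sym (ℕ.+-suc i (suc e))) (cong (λ k → i + k) e+2)) ⟩
      weight (i + suc T) (i + (suc t + n)) (i + (i + (suc t + n) + suc t)) ∎

  open Elimination entry α β ρ suc pivot entry-first entry-rest pivot-first pivot-rest

  factor : ℕ → ℚ
  factor m = fac (suc (2 * m)) ℚ.* fac (2 * m + 2 * n) ℚ.* (1/fac (2 * m + n) ℚ.* 1/fac (suc (2 * m + n)))

  pivot≡factor : ∀ i → pivot 0 i ≡ factor i
  pivot≡factor i = begin
    fac i ℚ.* (1ℚ ℚ.* 1/fac 2) ℚ.* fac (i + n + 0) ℚ.* weight (i + 1) (i + n) (i + (i + n + 0))
      ≡⟨ cong₂ (λ a b → fac i ℚ.* (1ℚ ℚ.* 1/fac 2) ℚ.* fac b ℚ.* weight a (i + n) (i + b))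
           (ℕ.+-comm i 1) (ℕ.+-identityʳ (i + n)) ⟩
    fac i ℚ.* (1ℚ ℚ.* 1/fac 2) ℚ.* fac (i + n) ℚ.* weight (suc i) (i + n) (i + (i + n))
      ≡⟨ cong₂ (λ a c → fac i ℚ.* (1ℚ ℚ.* 1/fac 2) ℚ.* fac (i + n) ℚ.*
             (a ℚ.* 1/fac (suc i) ℚ.* (fac (2 * (i + n)) ℚ.* 1/fac (i + n))
                ℚ.* (1/fac c ℚ.* 1/fac (suc c))))
           double (ℕ-solve 2 (λ i n → i ⊞ (i ⊞ n) ⊜ lit 2 ⊠ i ⊞ n) refl i n) ⟩
    fac i ℚ.* (1ℚ ℚ.* 1/fac 2) ℚ.* fac (i + n) ℚ.*
      (fac 2 ℚ.* ℕ→ℚ (suc i) ℚ.* fac (suc (2 * i)) ℚ.* 1/fac (suc i)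
        ℚ.* (fac (2 * (i + n)) ℚ.* 1/fac (i + n)) ℚ.* y)
      ≡⟨ solve 10 (λ f g₂ z z′ f₂ k f′ g x y →
           f :* (con 1ℚ :* g₂) :* z :* (f₂ :* k :* f′ :* g :* (x :* z′) :* y)
             := f₂ :* g₂ :* (z :* z′) :* (k :* f :* g) :* (f′ :* x :* y)) refl
           (fac i) (1/fac 2) (fac (i + n)) (1/fac (i + n)) (fac 2) (ℕ→ℚ (suc i))
           (fac (suc (2 * i))) (1/fac (suc i)) (fac (2 * (i + n))) y ⟩
    fac 2 ℚ.* 1/fac 2 ℚ.* (fac (i + n) ℚ.* 1/fac (i + n)) ℚ.* (ℕ→ℚ (suc i) ℚ.* fac i ℚ.* 1/fac (suc i))
      ℚ.* (fac (suc (2 * i)) ℚ.* fac (2 * (i + n)) ℚ.* y)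
      ≡⟨ cong₂ (λ p q → p ℚ.* q ℚ.* (fac (suc (2 * i)) ℚ.* fac (2 * (i + n)) ℚ.* y))
           (cong₂ ℚ._*_ (fac-*-1/fac 2) (fac-*-1/fac (i + n)))
           (trans (cong (ℚ._* 1/fac (suc i)) (sym (fac-suc i))) (fac-*-1/fac (suc i))) ⟩
    1ℚ ℚ.* 1ℚ ℚ.* 1ℚ ℚ.* (fac (suc (2 * i)) ℚ.* fac (2 * (i + n)) ℚ.* y)
      ≡⟨ solve 3 (λ a b y → con 1ℚ :* con 1ℚ :* con 1ℚ :* (a :* b :* y) := a :* b :* y) refl
           (fac (suc (2 * i))) (fac (2 * (i + n))) y ⟩
    fac (suc (2 * i)) ℚ.* fac (2 * (i + n)) ℚ.* y
      ≡⟨ cong (λ k → fac (suc (2 * i)) ℚ.* fac k ℚ.* y) (ℕ.*-distribˡ-+ 2 i n) ⟩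
    factor i ∎
    where
    y = 1/fac (2 * i + n) ℚ.* 1/fac (suc (2 * i + n))
    -- The factor 2 is written as `fac 2` because it has to cancel the `1/fac 2` that the pivot
    -- contains at `t = 0`.
    double : fac (2 * suc i) ≡ fac 2 ℚ.* ℕ→ℚ (suc i) ℚ.* fac (suc (2 * i))
    double = begin
      fac (2 * suc i)
        ≡⟨ cong fac (ℕ.+-suc (suc i) (i + 0)) ⟩
      fac (suc (suc (2 * i)))
        ≡⟨ fac-suc (suc (2 * i)) ⟩
      ℕ→ℚ (2 + 2 * i) ℚ.* fac (suc (2 * i))
        ≡⟨ cong (λ k → ℕ→ℚ k ℚ.* fac (suc (2 * i))) (ℕ.*-distribˡ-+ 2 1 i) ⟨
      ℕ→ℚ (2 * suc i) ℚ.* fac (suc (2 * i))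
        ≡⟨ cong (ℚ._* fac (suc (2 * i))) (ℕ→ℚ-homo-* 2 (suc i)) ⟩
      fac 2 ℚ.* ℕ→ℚ (suc i) ℚ.* fac (suc (2 * i)) ∎

  det-catalan : ∀ m → det m (λ i j → catalan (n + toℕ i + toℕ j)) ≡ ∏ m (λ i → factor (toℕ i))
  det-catalan m = begin
    det m (λ i j → catalan (n + toℕ i + toℕ j))
      ≡⟨ det-cong m (λ i j → trans (catalan≡moment (n + toℕ i + toℕ j))
           (cong (moment 1) (ℕ-solve 3 (λ n i j → n ⊞ i ⊞ j ⊜ j ⊞ (i ⊞ n)) refl n (toℕ i) (toℕ j)))) ⟩
    det m (λ i j → entry 0 (toℕ i) (toℕ j))
      ≡⟨ det-pivots m 0 ⟩
    ∏ m (λ i → pivot 0 (toℕ i))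
      ≡⟨ ∏-cong m (λ i → pivot≡factor (toℕ i)) ⟩
    ∏ m (λ i → factor (toℕ i)) ∎

open CatalanDeterminant using (factor; det-catalan)

-- The product formula

-- For `n = 0` and `n = 1` the product formula is empty and so independent of `m`; `factor-zero` and
-- `factor-one` are the matching ratios.
factor-zero : ∀ m → factor 0 m ≡ 1ℚ
factor-zero m = begin
  fac (suc (2 * m)) ℚ.* fac (2 * m + 0) ℚ.* (1/fac (2 * m + 0) ℚ.* 1/fac (suc (2 * m + 0)))
    ≡⟨ cong (λ k → fac (suc (2 * m)) ℚ.* fac k ℚ.* (1/fac k ℚ.* 1/fac (suc k))) (ℕ.+-identityʳ (2 * m)) ⟩
  fac (suc a) ℚ.* fac a ℚ.* (1/fac a ℚ.* 1/fac (suc a))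
    ≡⟨ solve 4 (λ x y y′ x′ → x :* y :* (y′ :* x′) := x :* x′ :* (y :* y′)) refl
         (fac (suc a)) (fac a) (1/fac a) (1/fac (suc a)) ⟩
  fac (suc a) ℚ.* 1/fac (suc a) ℚ.* (fac a ℚ.* 1/fac a)
    ≡⟨ cong₂ ℚ._*_ (fac-*-1/fac (suc a)) (fac-*-1/fac a) ⟩
  1ℚ ∎
  where a = 2 * m

factor-one : ∀ m → factor 1 m ≡ 1ℚ
factor-one m = begin
  fac (suc a) ℚ.* fac (a + 2) ℚ.* (1/fac (a + 1) ℚ.* 1/fac (suc (a + 1)))
    ≡⟨ cong₂ (λ k l → fac (suc a) ℚ.* fac k ℚ.* (1/fac l ℚ.* 1/fac (suc l))) (ℕ.+-comm a 2) (ℕ.+-comm a 1) ⟩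
  fac (suc a) ℚ.* fac (2 + a) ℚ.* (1/fac (suc a) ℚ.* 1/fac (2 + a))
    ≡⟨ solve 4 (λ x y x′ y′ → x :* y :* (x′ :* y′) := x :* x′ :* (y :* y′)) refl
         (fac (suc a)) (fac (2 + a)) (1/fac (suc a)) (1/fac (2 + a)) ⟩
  fac (suc a) ℚ.* 1/fac (suc a) ℚ.* (fac (2 + a) ℚ.* 1/fac (2 + a))
    ≡⟨ cong₂ ℚ._*_ (fac-*-1/fac (suc a)) (fac-*-1/fac (2 + a)) ⟩
  1ℚ ∎
  where a = 2 * m

productFormula : ℕ → ℕ → ℚ
productFormula k m =
  ∏[1… k ] (λ j → fact-ratio j (2 * j)) ℚ.* ∏[1… k ] (λ j → fact-ratio (2 * m + 2 * j) (2 * m + j))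

-- Makes the quotient of the product formula at m + 1 and m telescope over n.
factor-suc : ∀ n m →
  fact-ratio (2 * suc m + 2 * n) (2 * suc m + n) ℚ.* factor n m
    ≡ fact-ratio (2 * m + 2 * n) (2 * m + n) ℚ.* factor (suc n) m
factor-suc n m = begin
  fact-ratio (2 * suc m + 2 * n) (2 * suc m + n) ℚ.* factor n m
    ≡⟨ cong (ℚ._* factor n m) (trans (cong₂ fact-ratio
         (ℕ-solve 2 (λ m n → lit 2 ⊠ (lit 1 ⊞ m) ⊞ lit 2 ⊠ n ⊜ lit 2 ⊠ m ⊞ lit 2 ⊠ (lit 1 ⊞ n)) refl m n)
         (ℕ-solve 2 (λ m n → lit 2 ⊠ (lit 1 ⊞ m) ⊞ n ⊜ lit 1 ⊞ (lit 2 ⊠ m ⊞ (lit 1 ⊞ n))) refl m n))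
         (fact-ratio≡ b (suc d))) ⟩
  fac b ℚ.* 1/fac (suc d) ℚ.* (fac c ℚ.* fac a ℚ.* (1/fac e ℚ.* 1/fac (suc e)))
    ≡⟨ cong (λ k → fac b ℚ.* 1/fac (suc d) ℚ.* (fac c ℚ.* fac a ℚ.* (1/fac e ℚ.* 1/fac k)))
         (ℕ.+-suc (2 * m) n) ⟨
  fac b ℚ.* 1/fac (suc d) ℚ.* (fac c ℚ.* fac a ℚ.* (1/fac e ℚ.* 1/fac d))
    ≡⟨ solve 6 (λ b d′ c a e d → b :* d′ :* (c :* a :* (e :* d)) := a :* e :* (c :* b :* (d :* d′))) refl
         (fac b) (1/fac (suc d)) (fac c) (fac a) (1/fac e) (1/fac d) ⟩
  fac a ℚ.* 1/fac e ℚ.* factor (suc n) m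
    ≡⟨ cong (ℚ._* factor (suc n) m) (fact-ratio≡ a e) ⟨
  fact-ratio a e ℚ.* factor (suc n) m ∎
  where
  a = 2 * m + 2 * n
  b = 2 * m + 2 * suc n
  c = suc (2 * m)
  d = 2 * m + suc n
  e = 2 * m + n

-- Induction on `k`. The first product does not involve `m`; in the second, `factor-suc` says that
-- the ratio changes exactly by what the new term contributes.
productFormula-suc : ∀ k m → productFormula k (suc m) ≡ productFormula k m ℚ.* factor (suc k) m
productFormula-suc zero    m = cong (1ℚ ℚ.* 1ℚ ℚ.*_) (sym (factor-one m))
productFormula-suc (suc k) m = begin
  P ℚ.* x ℚ.* (Q′ ℚ.* y′)
    ≡⟨ solve 4 (λ P x Q y → P :* x :* (Q :* y) := P :* Q :* (x :* y)) refl P x Q′ y′ ⟩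
  P ℚ.* Q′ ℚ.* (x ℚ.* y′)
    ≡⟨ cong (ℚ._* (x ℚ.* y′)) (productFormula-suc k m) ⟩
  P ℚ.* Q ℚ.* factor (suc k) m ℚ.* (x ℚ.* y′)
    ≡⟨ solve 5 (λ P Q e x y → P :* Q :* e :* (x :* y) := P :* x :* Q :* (y :* e)) refl
         P Q (factor (suc k) m) x y′ ⟩
  P ℚ.* x ℚ.* Q ℚ.* (y′ ℚ.* factor (suc k) m)
    ≡⟨ cong (P ℚ.* x ℚ.* Q ℚ.*_) (factor-suc (suc k) m) ⟩
  P ℚ.* x ℚ.* Q ℚ.* (y ℚ.* factor (suc (suc k)) m)
    ≡⟨ solve 5 (λ P x Q y e → P :* x :* Q :* (y :* e) := P :* x :* (Q :* y) :* e) refl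
         P x Q y (factor (suc (suc k)) m) ⟩
  P ℚ.* x ℚ.* (Q ℚ.* y) ℚ.* factor (suc (suc k)) m ∎
  where
  P = ∏[1… k ] (λ j → fact-ratio j (2 * j))
  Q = ∏[1… k ] (λ j → fact-ratio (2 * m + 2 * j) (2 * m + j))
  Q′ = ∏[1… k ] (λ j → fact-ratio (2 * suc m + 2 * j) (2 * suc m + j))
  x = fact-ratio (suc k) (2 * suc k)
  y = fact-ratio (2 * m + 2 * suc k) (2 * m + suc k)
  y′ = fact-ratio (2 * suc m + 2 * suc k) (2 * suc m + suc k)

-- At `m = 0` each factor of the second product is the inverse of the corresponding factor of the
-- first.
productFormula-zero : ∀ k → productFormula k 0 ≡ 1ℚ
productFormula-zero k = trans (sym (∏[1…]-distrib-* k _ _)) (trivial k)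
  where
  trivial : ∀ k → ∏[1… k ] (λ j → fact-ratio j (2 * j) ℚ.* fact-ratio (2 * j) j) ≡ 1ℚ
  trivial zero    = refl
  trivial (suc k) = trans (cong (ℚ._* (fact-ratio j (2 * j) ℚ.* fact-ratio (2 * j) j)) (trivial k))
    (trans (ℚ.*-identityˡ _) (begin
      fact-ratio j (2 * j) ℚ.* fact-ratio (2 * j) j
        ≡⟨ cong₂ ℚ._*_ (fact-ratio≡ j (2 * j)) (fact-ratio≡ (2 * j) j) ⟩
      fac j ℚ.* 1/fac (2 * j) ℚ.* (fac (2 * j) ℚ.* 1/fac j)
        ≡⟨ solve 4 (λ x y′ y x′ → x :* y′ :* (y :* x′) := x :* x′ :* (y :* y′)) refl
             (fac j) (1/fac (2 * j)) (fac (2 * j)) (1/fac j) ⟩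
      fac j ℚ.* 1/fac j ℚ.* (fac (2 * j) ℚ.* 1/fac (2 * j))
        ≡⟨ cong₂ ℚ._*_ (fac-*-1/fac j) (fac-*-1/fac (2 * j)) ⟩
      1ℚ ∎))
    where j = suc k

-- Telescoping in `m` from the value 1 at `m = 0`. The case `n = 0` stands apart because `n ∸ 1` is
-- truncated there, so `productFormula-suc` would yield `factor 1` in place of `factor 0`.
productFormula≡∏-factor : ∀ n m → productFormula (n ∸ 1) m ≡ ∏ m (λ i → factor n (toℕ i))
productFormula≡∏-factor n       zero    = productFormula-zero (n ∸ 1)
productFormula≡∏-factor zero    (suc m) = sym (∏-one (suc m) (λ i → factor-zero (toℕ i)))
productFormula≡∏-factor (suc k) (suc m) = begin
  productFormula k (suc m)
    ≡⟨ productFormula-suc k m ⟩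
  productFormula k m ℚ.* factor (suc k) m
    ≡⟨ cong (ℚ._* factor (suc k) m) (productFormula≡∏-factor (suc k) m) ⟩
  ∏ m (λ i → factor (suc k) (toℕ i)) ℚ.* factor (suc k) m
    ≡⟨ ∏-snoc m (factor (suc k)) ⟨
  ∏ (suc m) (λ i → factor (suc k) (toℕ i)) ∎

theorem4 : (n m : ℕ) →
    (det n (λ i j → ℕ→ℚ (binom (toℕ i + toℕ j + m) ((+ (toℕ i + m)) ℤ.- (+ toℕ j))))
      ≡ (∏[1… n ∸ 1 ] (λ j → fact-ratio j (2 * j))
          ℚ.* ∏[1… n ∸ 1 ] (λ j → fact-ratio (2 * m + 2 * j) (2 * m + j))))
    × ((∏[1… n ∸ 1 ] (λ j → fact-ratio j (2 * j))
          ℚ.* ∏[1… n ∸ 1 ] (λ j → fact-ratio (2 * m + 2 * j) (2 * m + j)))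
      ≡ det m (λ i j → catalan (n + toℕ i + toℕ j)))
theorem4 n m = binomial , trans (productFormula≡∏-factor n m) (sym (det-catalan n m))
  where
  f g : ℕ → ℚ
  f j = fact-ratio j (2 * j)
  g j = fact-ratio (2 * m + 2 * j) (2 * m + j)

  -- The term at `j = 0`, present in the product over `Fin n` but not in the theorem, is `(2 * m) !`
  -- over itself.
  f*g-zero : f 0 ℚ.* g 0 ≡ 1ℚ
  f*g-zero = trans (ℚ.*-identityˡ (g 0))
    (trans (fact-ratio≡ (2 * m + 0) (2 * m + 0)) (fac-*-1/fac (2 * m + 0)))

  binomial : det n (λ i j → ℕ→ℚ (binom (toℕ i + toℕ j + m) ((+ (toℕ i + m)) ℤ.- (+ toℕ j))))
    ≡ productFormula (n ∸ 1) m
  binomial = begin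
    det n (λ i j → ℕ→ℚ (binom (toℕ i + toℕ j + m) ((+ (toℕ i + m)) ℤ.- (+ toℕ j))))
      ≡⟨ BinomialDeterminant.det-binom m n ⟩
    ∏ n (λ i → f (toℕ i) ℚ.* g (toℕ i))
      ≡⟨ ∏≡∏[1…] n (λ j → f j ℚ.* g j) f*g-zero ⟩
    ∏[1… n ∸ 1 ] (λ j → f j ℚ.* g j)
      ≡⟨ ∏[1…]-distrib-* (n ∸ 1) f g ⟩
    productFormula (n ∸ 1) m ∎
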